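{- For all $n\ge0$, $$H_n\big(E_{2k+5}(1)\big)=\left(\frac12\right)^{n+1}\overline{\mathcal{H}}_{n+1}\cdot\prod_{\ell=1}^{n+1}\left(\frac{\ell^2(2\ell+1)(2\ell-1)}{4}\right)^{n+2-\ell},$$ where $E_j(x)$ are the Euler polynomials and $\overline{\mathcal{H}}_m:=\sum_{j=0}^m\frac{1}{2j+1}$.
   Context: For a sequence $(a_k)_{k\ge 0}$ and $n\ge 0$, $H_n(a_k):=\det(a_{i+j})_{0\le i,j\le n}$ denotes the $(n+1)\times(n+1)$ Hankel determinant; here the sequence is $(E_{2k+5}(1))_{k\ge0}$. The Euler polynomials are defined by $\frac{2e^{xt}}{e^t+1}=\sum_{n\ge0}E_n(x)\frac{t^n}{n!}$. -}

module Defs where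

open import Data.Fin.Base using (Fin; zero; suc; toℕ; punchIn)
open import Data.Integer.Base as ℤ using ()
open import Data.Nat.Base as ℕ using (ℕ; zero; suc; _∸_; _!)
import Data.Nat.Properties as ℕ
open import Data.Rational.Base
  using (ℚ; 0ℚ; 1ℚ; _+_; _*_; _-_; -_; 1/_; _÷_; _/_; NonZero)
open import Data.Rational.Properties
open import Data.Rational.Unnormalised.Base using (*≡*; mkℚᵘ)
import Data.Rational.Unnormalised.Properties as ℚᵘ
open import Relation.Binary.PropositionalEquality
  using (_≡_; _≗_; cong; sym; trans; module ≡-Reasoning)

open import Algebra.Definitions.RawSemiring +-*-rawSemiring public
  using (_^_; product)
open import Algebra.Properties.Monoid.Sum +-0-monoid public
  using (sum-syntax; sum-cong-≗)

infixr 7 ∏₁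
∏₁ : ∀ m → (ℕ → ℚ) → ℚ
∏₁ m f = product {m} λ i → f (suc (toℕ i))

syntax ∏₁ m (λ ℓ → e) = ∏[1≤ ℓ ≤ m ] e

fromℕ : ℕ → ℚ
fromℕ n = ℤ.+ n / 1

------------------------------------------------------------------------
-- Hankel determinants

Matrix : ℕ → Set
Matrix n = Fin n → Fin n → ℚ

-- Laplace expansion along the first row.
det : ∀ {n} → Matrix n → ℚ
det {zero}  A = 1ℚ
det {suc n} A =
  ∑[ j < suc n ] ((- 1ℚ) ^ toℕ j * A zero j * det λ r c → A (suc r) (punchIn j c))

-- The matrix has size n + 1, its indices running over 0, …, n.
H : ℕ → (ℕ → ℚ) → ℚ
H n a = det {suc n} λ i j → a (toℕ i ℕ.+ toℕ j)

------------------------------------------------------------------------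
-- Formal power series in t, as coefficient sequences

Series : Set
Series = ℕ → ℚ

infixl 6 _⊕_
infixl 7 _⊛_ _⊘_ _·_

_⊕_ : Series → Series → Series
(f ⊕ g) n = f n + g n

_·_ : ℚ → Series → Series
(c · f) n = c * f n

_⊛_ : Series → Series → Series
(f ⊛ g) n = ∑[ i < suc n ] (f (toℕ i) * g (n ∸ toℕ i))

one : Series
one zero    = 1ℚ
one (suc _) = 0ℚ

-- Long division: with c = f₀ / g₀, one has f / g = c + t · (f′ / g)
-- where f′ = (f - c g) / t.
_⊘_ : (f g : Series) .{{_ : NonZero (g 0)}} → Series
(f ⊘ g) zero    = f 0 ÷ g 0
(f ⊘ g) (suc n) = ((λ k → f (suc k) - (f 0 ÷ g 0) * g (suc k)) ⊘ g) n

recip! : ℕ → ℚ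
recip! n = _/_ (ℤ.+ 1) (n !) {{n ℕ.!≢0}}

-- The expansion of e^{xt}.
exp : ℚ → Series
exp x n = x ^ n * recip! n

-- The value at x of the n-th Euler polynomial: n! times the coefficient
-- of tⁿ in 2e^{xt} / (e^t + 1).
E : ℕ → ℚ → ℚ
E n x = fromℕ (n !) * ((fromℕ 2 · exp x) ⊘ (exp 1ℚ ⊕ one)) n

------------------------------------------------------------------------
-- The defining generating function of E

⊘-⊛ : ∀ f g .{{_ : NonZero (g 0)}} → (f ⊘ g) ⊛ g ≗ f
⊘-⊛ f g zero = begin
  f 0 * 1/ g 0 * g 0 + 0ℚ  ≡⟨ +-identityʳ _ ⟩
  f 0 * 1/ g 0 * g 0       ≡⟨ *-assoc (f 0) (1/ g 0) (g 0) ⟩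
  f 0 * (1/ g 0 * g 0)     ≡⟨ cong (f 0 *_) (*-inverseˡ (g 0)) ⟩
  f 0 * 1ℚ                 ≡⟨ *-identityʳ (f 0) ⟩
  f 0                      ∎
  where open ≡-Reasoning
⊘-⊛ f g (suc n) = begin
  d + (f′ ⊘ g ⊛ g) n       ≡⟨ cong (d +_) (⊘-⊛ f′ g n) ⟩
  d + (f (suc n) - d)      ≡⟨ +-comm d _ ⟩
  f (suc n) - d + d        ≡⟨ +-assoc (f (suc n)) (- d) d ⟩
  f (suc n) + (- d + d)    ≡⟨ cong (f (suc n) +_) (+-inverseˡ d) ⟩
  f (suc n) + 0ℚ           ≡⟨ +-identityʳ _ ⟩
  f (suc n)                ∎
  where
  open ≡-Reasoning
  d  = (f 0 ÷ g 0) * g (suc n)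
  f′ = λ k → f (suc k) - (f 0 ÷ g 0) * g (suc k)

n!*recip!≡1 : ∀ n → fromℕ (n !) * recip! n ≡ 1ℚ
n!*recip!≡1 n = go (n !) {{n ℕ.!≢0}}
  where
  go : ∀ m .{{_ : ℕ.NonZero m}} → fromℕ m * (ℤ.+ 1 / m) ≡ 1ℚ
  go m@(suc k) = toℚᵘ-injective (ℚᵘ.≃-trans (toℚᵘ-homo-* (fromℕ m) (ℤ.+ 1 / m))
    (ℚᵘ.≃-trans (ℚᵘ.*-cong (toℚᵘ-fromℚᵘ (mkℚᵘ (ℤ.+ m) 0)) (toℚᵘ-fromℚᵘ (mkℚᵘ (ℤ.+ 1) k)))
      (*≡* (cong ℤ.+_ (lemma k)))))
    where
    lemma : ∀ k → suc k ℕ.* 1 ℕ.* 1 ≡ 1 ℕ.* (1 ℕ.* suc k)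
    lemma k = trans (trans (ℕ.*-identityʳ _) (ℕ.*-identityʳ _))
      (sym (trans (ℕ.*-identityˡ _) (ℕ.*-identityˡ _)))

E-generating : ∀ x →
  (λ n → E n x * recip! n) ⊛ (exp 1ℚ ⊕ one) ≗ fromℕ 2 · exp x
E-generating x n = trans
  (sum-cong-≗ {n = suc n} λ i → cong (_* (exp 1ℚ ⊕ one) (n ∸ toℕ i)) (cancel (toℕ i)))
  (⊘-⊛ (fromℕ 2 · exp x) (exp 1ℚ ⊕ one) n)
  where
  q = (fromℕ 2 · exp x) ⊘ (exp 1ℚ ⊕ one)
  cancel : ∀ k → E k x * recip! k ≡ q k
  cancel k = begin
    fromℕ (k !) * q k * recip! k    ≡⟨ cong (_* recip! k) (*-comm (fromℕ (k !)) (q k)) ⟩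
    q k * fromℕ (k !) * recip! k    ≡⟨ *-assoc (q k) _ _ ⟩
    q k * (fromℕ (k !) * recip! k)  ≡⟨ cong (q k *_) (n!*recip!≡1 k) ⟩
    q k * 1ℚ                        ≡⟨ *-identityʳ (q k) ⟩
    q k                             ∎
    where open ≡-Reasoning

------------------------------------------------------------------------
-- Sums of odd reciprocals, 1/1 + 1/3 + ⋯ + 1/(2m+1)

H̅ : ℕ → ℚ
H̅ m = ∑[ j < suc m ] (ℤ.+ 1 / suc (2 ℕ.* toℕ j))

{-# OPTIONS --safe #-}

-- Put z = tanh(t/2).  Then 2e^t/(e^t + 1) = 1 + z, so E_n(1) = n! [tⁿ] z for n ≥ 1.  Since
-- dz^m/dt = (m/2)(z^(m-1) - z^(m+1)), the numbers T n m = n! [tⁿ] z^m satisfy a recurrence in m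
-- that is self-adjoint up to a diagonal scaling, which writes E_{2(i+j)+5}(1) as the quadratic form
--   ½ ∑_p (2p+1) (w_p - w_{p+1})(i) (w_p - w_{p+1})(j),   w_p(i) = T (2i+2) (2p).
-- Completing squares in w_1, w_2, … is reducing a chain of resistors in series: after w_1, …, w_p
-- the coefficient left on the square of w_{p+1} is 1/H̅_p.  As w_p(i) = 0 for p > i + 1, this is an
-- LU decomposition of the Hankel matrix whose pivots give the product formula.
module Submission where

open import Defs
open import Algebra.Bundles using (CommutativeRing; Monoid)
import Algebra.Properties.Monoid.Sum as MonoidSum
open import Data.Fin.Base using (Fin; zero; suc; toℕ; punchIn)
open import Data.Fin.Properties using (toℕ≤pred[n])
open import Data.Integer.Base as ℤ using ()
import Data.Integer.Properties as ℤ
open import Data.Nat.Base as ℕ using (ℕ; zero; suc; pred; _∸_; _!)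
import Data.Nat.Properties as ℕ
open import Data.Rational.Base
  using (ℚ; ½; 1ℚ; 0ℚ; _*_; _+_; _-_; -_; _/_; 1/_; NonZero; Positive; fromℚᵘ)
open import Data.Rational.Properties
open import Data.Rational.Unnormalised.Base as ℚᵘ using (mkℚᵘ; *≡*)
import Data.Rational.Unnormalised.Properties as ℚᵘ
open import Data.Vec.Functional using (Vector; _∷_)
open import Function.Base using (_∘_)
open import Level using (0ℓ)
open import Relation.Binary.PropositionalEquality
open import Relation.Nullary.Decidable using (dec⇒maybe)
open import Tactic.RingSolver using (solve-∀)
open import Tactic.RingSolver.Core.AlmostCommutativeRing
  using (AlmostCommutativeRing; fromCommutativeRing)

open import Algebra.Properties.Semiring.Sum (CommutativeRing.semiring +-*-commutativeRing)
  using (sum; ∑-distrib-+; *-distribˡ-sum; sum-replicate-zero)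
open import Algebra.Properties.CommutativeMonoid.Sum *-1-commutativeMonoid
  using ()
  renaming ( ∑-distrib-+ to ∏-distrib-*; sum-cong-≗ to product-cong
           ; sum-replicate to product-replicate)

open ≡-Reasoning

ring : AlmostCommutativeRing 0ℓ 0ℓ
ring = fromCommutativeRing +-*-commutativeRing λ x → dec⇒maybe (0ℚ ≟ x)

-- Finite sums and products

∑-linear : ∀ {n} a b (f g : Vector ℚ n) →
  ∑[ i < n ] (a * f i + b * g i) ≡ a * sum f + b * sum g
∑-linear a b f g = trans (∑-distrib-+ (λ i → a * f i) (λ i → b * g i))
  (sym (cong₂ _+_ (*-distribˡ-sum a f) (*-distribˡ-sum b g)))

∑-zero : ∀ {n} {f : Vector ℚ n} → (∀ i → f i ≡ 0ℚ) → sum f ≡ 0ℚ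
∑-zero {n} f≗0 = trans (sum-cong-≗ f≗0) (sum-replicate-zero n)

module _ (M : Monoid 0ℓ 0ℓ) where
  open Monoid M using (Carrier; _≈_; _∙_; identityˡ; identityʳ; assoc; ∙-congˡ)
    renaming (trans to ≈-trans; sym to ≈-sym)
  open MonoidSum M using () renaming (sum to sumᴹ)

  -- Stated over a monoid so that it serves both the sums and the products of rationals.
  sum-last : ∀ n (f : ℕ → Carrier) → sumᴹ {suc n} (f ∘ toℕ) ≈ sumᴹ {n} (f ∘ toℕ) ∙ f n
  sum-last zero    f = ≈-trans (identityʳ (f 0)) (≈-sym (identityˡ (f 0)))
  sum-last (suc n) f = ≈-trans (∙-congˡ (sum-last n (f ∘ suc))) (≈-sym (assoc (f 0) _ _))

∑-last : ∀ n (f : ℕ → ℚ) → ∑[ i < suc n ] f (toℕ i) ≡ ∑[ i < n ] f (toℕ i) + f n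
∑-last = sum-last +-0-monoid

-- The factor `b ℓ` occurs in the inner products with i ≥ ℓ - 1, hence n + 1 - ℓ times. The
-- induction takes `b 1` out of all of them and shifts `b`.
∏-∏₁ : ∀ n (b : ℕ → ℚ) →
  product {n} (λ i → ∏₁ (suc (toℕ i)) b) ≡ ∏[1≤ ℓ ≤ n ] (b ℓ ^ (suc n ∸ ℓ))
∏-∏₁ zero    b = refl
∏-∏₁ (suc n) b = begin
  product {suc n} (λ i → b 1 * ∏₁ (toℕ i) (b ∘ suc))
    ≡⟨ ∏-distrib-* {suc n} (λ _ → b 1) (λ i → ∏₁ (toℕ i) (b ∘ suc)) ⟩
  product {suc n} (λ _ → b 1) * (1ℚ * product {n} (λ i → ∏₁ (suc (toℕ i)) (b ∘ suc)))
    ≡⟨ cong₂ _*_ (product-replicate (suc n) {b 1}) (trans (*-identityˡ _) (∏-∏₁ n (b ∘ suc))) ⟩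
  b 1 ^ suc n * (∏[1≤ ℓ ≤ n ] (b (suc ℓ) ^ (suc n ∸ ℓ))) ∎

product-telescope : ∀ n (f f⁻¹ : ℕ → ℚ) → (∀ k → f k * f⁻¹ k ≡ 1ℚ) →
  product {n} (λ i → f (suc (toℕ i)) * f⁻¹ (toℕ i)) ≡ f n * f⁻¹ 0
product-telescope zero    f f⁻¹ inv = sym (inv 0)
product-telescope (suc n) f f⁻¹ inv = begin
  f 1 * f⁻¹ 0 * product {n} (λ i → f (suc (suc (toℕ i))) * f⁻¹ (suc (toℕ i)))
    ≡⟨ cong (f 1 * f⁻¹ 0 *_) (product-telescope n (f ∘ suc) (f⁻¹ ∘ suc) (inv ∘ suc)) ⟩
  f 1 * f⁻¹ 0 * (f (suc n) * f⁻¹ 1)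
    ≡⟨ rearrange (f 1) (f⁻¹ 0) (f (suc n)) (f⁻¹ 1) ⟩
  f 1 * f⁻¹ 1 * (f (suc n) * f⁻¹ 0)
    ≡⟨ cong (_* (f (suc n) * f⁻¹ 0)) (inv 1) ⟩
  1ℚ * (f (suc n) * f⁻¹ 0)
    ≡⟨ *-identityˡ (f (suc n) * f⁻¹ 0) ⟩
  f (suc n) * f⁻¹ 0 ∎
  where
  rearrange : ∀ a b c d → a * b * (c * d) ≡ a * d * (c * b)
  rearrange = solve-∀ ring

-- Determinants

sgn : ∀ {n} → Fin n → ℚ
sgn j = (- 1ℚ) ^ toℕ j

det-cong : ∀ {n} {A B : Matrix n} → (∀ i j → A i j ≡ B i j) → det A ≡ det B
det-cong {zero}  A≗B = refl
det-cong {suc n} A≗B = sum-cong-≗ λ j →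
  cong₂ _*_ (cong (sgn j *_) (A≗B zero j)) (det-cong λ r c → A≗B (suc r) (punchIn j c))

-- Laplace expansion with the first column `x` set apart. Deleting a later column keeps `x` in front
-- of the minor, and its sign (-1)^(l+1) accounts for the subtraction.
det-∷ : ∀ {n} (x : Vector ℚ (suc (suc n))) (A : Fin (suc (suc n)) → Vector ℚ (suc n)) →
  det (λ i → x i ∷ A i)
    ≡ x zero * det (A ∘ suc)
      - ∑[ l < suc n ] (sgn l * A zero l * det λ r → x (suc r) ∷ A (suc r) ∘ punchIn l)
det-∷ {n} x A = begin
  1ℚ * x zero * d + ∑[ l < suc n ] (- 1ℚ * sgn l * A zero l * m l)
    ≡⟨ cong₂ _+_ (cong (_* d) (*-identityˡ (x zero)))
         (trans (sum-cong-≗ λ l → trans (rearrange (sgn l) (A zero l) (m l))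
           (cong (λ z → - 1ℚ * (sgn l * A zero l * z)) (det-cong (minor l))))
           (sym (*-distribˡ-sum (- 1ℚ) t))) ⟩
  x zero * d + - 1ℚ * sum t
    ≡⟨ neg (x zero * d) (sum t) ⟩
  x zero * d - sum t ∎
  where
  d = det (A ∘ suc)
  m : Fin (suc n) → ℚ
  m l = det λ r c → (x (suc r) ∷ A (suc r)) (punchIn (suc l) c)
  t : Vector ℚ (suc n)
  t l = sgn l * A zero l * det λ r → x (suc r) ∷ A (suc r) ∘ punchIn l
  minor : ∀ l r c → (x (suc r) ∷ A (suc r)) (punchIn (suc l) c)
                  ≡ (x (suc r) ∷ A (suc r) ∘ punchIn l) c
  minor l r zero    = refl
  minor l r (suc c) = refl
  rearrange : ∀ s a z → - 1ℚ * s * a * z ≡ - 1ℚ * (s * a * z)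
  rearrange = solve-∀ ring
  neg : ∀ a z → a + - 1ℚ * z ≡ a - z
  neg = solve-∀ ring

-- Column selections reached along different routes agree only pointwise, so minors must respect
-- pointwise equality.
Extensional : ∀ {m n} → ((Fin m → Fin n) → ℚ) → Set
Extensional G = ∀ {f g} → (∀ c → f c ≡ g c) → G f ≡ G g

-- Expansion along two rows x and y, with G for the minor on the remaining columns.
∑∑ : ∀ {n} (x y : Vector ℚ (suc (suc n))) → ((Fin n → Fin (suc (suc n))) → ℚ) → ℚ
∑∑ {n} x y G = ∑[ k < suc (suc n) ] (sgn k * x k *
  ∑[ l < suc n ] (sgn l * y (punchIn k l) * G (punchIn k ∘ punchIn l)))

lift : ∀ {m n} → (Fin m → Fin n) → Fin (suc m) → Fin (suc n)
lift h zero    = zero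
lift h (suc c) = suc (h c)

-- Column zero is used by `x`, by `y`, or by neither. The first two cases give the single sums `R`,
-- with opposite signs because of the order of the two rows; in the third, column zero stays in the
-- minor, which is what `lift` records.
∑∑-suc : ∀ {n} (x y : Vector ℚ (suc (suc (suc n)))) G → Extensional G →
  let R = λ z → ∑[ l < suc (suc n) ] (sgn l * z (suc l) * G (suc ∘ punchIn l)) in
  ∑∑ x y G ≡ x zero * R y - y zero * R x + ∑∑ (x ∘ suc) (y ∘ suc) (G ∘ lift)
∑∑-suc {n} x y G ext = begin
  1ℚ * x zero * R y + ∑[ k < suc (suc n) ] (- 1ℚ * sgn k * x (suc k) *
      (1ℚ * y zero * G (punchIn (suc k) ∘ suc) + ∑[ l < suc n ] u k l))
    ≡⟨ cong (1ℚ * x zero * R y +_) (sum-cong-≗ λ k → trans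
         (cong (λ z → - 1ℚ * sgn k * x (suc k) * (1ℚ * y zero * G (suc ∘ punchIn k) + z))
           (trans (sum-cong-≗ λ l → trans
               (cong (- 1ℚ * sgn l * y (suc (punchIn k l)) *_) (ext (punchIn² k l)))
               (pull (sgn l) (y (suc (punchIn k l))) (G′ k l)))
             (sym (*-distribˡ-sum (- 1ℚ) (v k)))))
         (split (sgn k) (x (suc k)) (y zero) (G (suc ∘ punchIn k)) (sum (v k)))) ⟩
  1ℚ * x zero * R y + ∑[ k < suc (suc n) ] ((- y zero) * p k + 1ℚ * q k)
    ≡⟨ cong (1ℚ * x zero * R y +_) (∑-linear (- y zero) 1ℚ p q) ⟩
  1ℚ * x zero * R y + ((- y zero) * R x + 1ℚ * sum q)
    ≡⟨ tidy (x zero) (R y) (y zero) (R x) (sum q) ⟩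
  x zero * R y - y zero * R x + ∑∑ (x ∘ suc) (y ∘ suc) (G ∘ lift) ∎
  where
  R : Vector ℚ (suc (suc (suc n))) → ℚ
  R z = ∑[ l < suc (suc n) ] (sgn l * z (suc l) * G (suc ∘ punchIn l))
  G′ : Fin (suc (suc n)) → Fin (suc n) → ℚ
  G′ k l = G (lift (punchIn k ∘ punchIn l))
  u v : Fin (suc (suc n)) → Fin (suc n) → ℚ
  u k l = - 1ℚ * sgn l * y (suc (punchIn k l)) * G (punchIn (suc k) ∘ punchIn (suc l))
  v k l = sgn l * y (suc (punchIn k l)) * G′ k l
  p q : Vector ℚ (suc (suc n))
  p k = sgn k * x (suc k) * G (suc ∘ punchIn k)
  q k = sgn k * x (suc k) * sum (v k)
  punchIn² : ∀ k l c → punchIn (suc k) (punchIn (suc l) c) ≡ lift (punchIn k ∘ punchIn l) c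
  punchIn² k l zero    = refl
  punchIn² k l (suc c) = refl
  pull : ∀ s a z → - 1ℚ * s * a * z ≡ - 1ℚ * (s * a * z)
  pull = solve-∀ ring
  split : ∀ s a y g z → - 1ℚ * s * a * (1ℚ * y * g + - 1ℚ * z) ≡ (- y) * (s * a * g) + 1ℚ * (s * a * z)
  split = solve-∀ ring
  tidy : ∀ a r b r′ z → 1ℚ * a * r + ((- b) * r′ + 1ℚ * z) ≡ a * r - b * r′ + z
  tidy = solve-∀ ring

-- Induction on the number of columns: in `∑∑-suc` the two single sums trade places with a change of
-- sign, and the double sum left over has one column fewer.
∑∑-antisym : ∀ {n} (x y : Vector ℚ (suc (suc n))) G → Extensional G → ∑∑ x y G ≡ - ∑∑ y x G
∑∑-antisym {zero} x y G ext = begin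
  ∑∑ x y G                       ≡⟨ value x y ⟩
  x₀ * y₁ * g - x₁ * y₀ * g      ≡⟨ swap x₀ x₁ y₀ y₁ g ⟩
  - (y₀ * x₁ * g - y₁ * x₀ * g)  ≡⟨ cong -_ (value y x) ⟨
  - ∑∑ y x G                     ∎
  where
  x₀ = x zero
  x₁ = x (suc zero)
  y₀ = y zero
  y₁ = y (suc zero)
  g  = G λ ()
  expr : (x₀ x₁ y₀ y₁ g h : ℚ) → ℚ
  expr x₀ x₁ y₀ y₁ g h = 1ℚ * x₀ * (1ℚ * y₁ * g + 0ℚ)
    + ((- 1ℚ * 1ℚ) * x₁ * (1ℚ * y₀ * h + 0ℚ) + 0ℚ)
  simplify : ∀ x₀ x₁ y₀ y₁ g → 1ℚ * x₀ * (1ℚ * y₁ * g + 0ℚ)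
    + ((- 1ℚ * 1ℚ) * x₁ * (1ℚ * y₀ * g + 0ℚ) + 0ℚ) ≡ x₀ * y₁ * g - x₁ * y₀ * g
  simplify = solve-∀ ring
  value : ∀ x y → ∑∑ x y G ≡ x zero * y (suc zero) * g - x (suc zero) * y zero * g
  value x y = trans
    (cong₂ (expr (x zero) (x (suc zero)) (y zero) (y (suc zero)))
      (ext {f = punchIn zero ∘ punchIn zero} λ ())
      (ext {f = punchIn (suc zero) ∘ punchIn zero} λ ()))
    (simplify (x zero) (x (suc zero)) (y zero) (y (suc zero)) g)
  swap : ∀ x₀ x₁ y₀ y₁ g → x₀ * y₁ * g - x₁ * y₀ * g ≡ - (y₀ * x₁ * g - y₁ * x₀ * g)
  swap = solve-∀ ring
∑∑-antisym {suc n} x y G ext = begin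
  ∑∑ x y G
    ≡⟨ ∑∑-suc x y G ext ⟩
  x zero * R y - y zero * R x + ∑∑ (x ∘ suc) (y ∘ suc) (G ∘ lift)
    ≡⟨ cong (x zero * R y - y zero * R x +_) (∑∑-antisym (x ∘ suc) (y ∘ suc) (G ∘ lift) (ext ∘ lift-cong)) ⟩
  x zero * R y - y zero * R x - ∑∑ (y ∘ suc) (x ∘ suc) (G ∘ lift)
    ≡⟨ swap (x zero * R y) (y zero * R x) _ ⟩
  - (y zero * R x - x zero * R y + ∑∑ (y ∘ suc) (x ∘ suc) (G ∘ lift))
    ≡⟨ cong -_ (∑∑-suc y x G ext) ⟨
  - ∑∑ y x G ∎
  where
  R : Vector ℚ (suc (suc (suc n))) → ℚ
  R z = ∑[ l < suc (suc n) ] (sgn l * z (suc l) * G (suc ∘ punchIn l))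
  lift-cong : ∀ {m n} {f g : Fin m → Fin n} → (∀ c → f c ≡ g c) → ∀ c → lift f c ≡ lift g c
  lift-cong f≗g zero    = refl
  lift-cong f≗g (suc c) = cong suc (f≗g c)
  swap : ∀ a b c → a - b - c ≡ - (b - a + c)
  swap = solve-∀ ring

-- By antisymmetry the sum is its own negative, and 2 is invertible.
∑∑-diag : ∀ {n} (x : Vector ℚ (suc (suc n))) G → Extensional G → ∑∑ x x G ≡ 0ℚ
∑∑-diag x G ext = begin
  ∑∑ x x G                   ≡⟨ halve (∑∑ x x G) ⟩
  ½ * (∑∑ x x G + ∑∑ x x G)  ≡⟨ cong (λ z → ½ * (∑∑ x x G + z)) (∑∑-antisym x x G ext) ⟩
  ½ * (∑∑ x x G - ∑∑ x x G)  ≡⟨ cancel (∑∑ x x G) ⟩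
  0ℚ                         ∎
  where
  halve : ∀ a → a ≡ ½ * (a + a)
  halve = solve-∀ ring
  cancel : ∀ a → ½ * (a - a) ≡ 0ℚ
  cancel = solve-∀ ring

-- The matrix determinant lemma: the determinant is affine in `c`, since the terms of second order
-- pair `c` with itself and vanish by `∑∑-diag`.
det-rank-one : ∀ {n} (B : Matrix (suc n)) (b c : Vector ℚ (suc n)) →
  det (λ i j → B i j - b i * c j)
    ≡ det B - ∑[ j < suc n ] (sgn j * c j * det λ i → b i ∷ B i ∘ punchIn j)
det-rank-one {zero} B b c = base (B zero zero) (b zero) (c zero)
  where
  base : ∀ B b c → 1ℚ * (B - b * c) * 1ℚ + 0ℚ
    ≡ 1ℚ * B * 1ℚ + 0ℚ - (1ℚ * c * (1ℚ * b * 1ℚ + 0ℚ) + 0ℚ)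
  base = solve-∀ ring
det-rank-one {suc n} B b c = begin
  ∑[ k < suc (suc n) ] (sgn k * (B₀ k - b₀ * c k)
      * det λ i j → B (suc i) (punchIn k j) - b (suc i) * c (punchIn k j))
    ≡⟨ sum-cong-≗ (λ k → trans
         (cong (sgn k * (B₀ k - b₀ * c k) *_)
           (det-rank-one (λ i j → B (suc i) (punchIn k j)) (b ∘ suc) (c ∘ punchIn k)))
         (split (sgn k) (B₀ k) b₀ (c k) (D k) _)) ⟩
  ∑[ k < suc (suc n) ] (1ℚ * (1ℚ * p k + - 1ℚ * q k) + (- b₀) * (1ℚ * r k + - 1ℚ * s k))
    ≡⟨ trans
         (∑-linear 1ℚ (- b₀) (λ k → 1ℚ * p k + - 1ℚ * q k) (λ k → 1ℚ * r k + - 1ℚ * s k))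
         (cong₂ (λ y z → 1ℚ * y + (- b₀) * z) (∑-linear 1ℚ (- 1ℚ) p q) (∑-linear 1ℚ (- 1ℚ) r s)) ⟩
  1ℚ * (1ℚ * det B + - 1ℚ * ∑∑ B₀ c G) + (- b₀) * (1ℚ * sum r + - 1ℚ * ∑∑ c c G)
    -- Exchanging `B₀` and `c` produces the double sum that arises when the determinants with first
    -- column `b` are expanded by `det-∷`.
    ≡⟨ cong₂ (λ y z → 1ℚ * (1ℚ * det B + - 1ℚ * y) + (- b₀) * (1ℚ * sum r + - 1ℚ * z))
         (∑∑-antisym B₀ c G G-ext) (∑∑-diag c G G-ext) ⟩
  1ℚ * (1ℚ * det B + - 1ℚ * (- ∑∑ c B₀ G)) + (- b₀) * (1ℚ * sum r + - 1ℚ * 0ℚ)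
    ≡⟨ tidy (det B) (∑∑ c B₀ G) b₀ (sum r) ⟩
  det B - (b₀ * sum r + - 1ℚ * ∑∑ c B₀ G)
    ≡⟨ cong (λ z → det B - z) (trans (sum-cong-≗ λ j → trans
           (cong (sgn j * c j *_) (det-∷ b (λ i → B i ∘ punchIn j)))
           (split′ (sgn j) (c j) b₀ (D j) _))
         (∑-linear b₀ (- 1ℚ) r u)) ⟨
  det B - ∑[ j < suc (suc n) ] (sgn j * c j * det λ i → b i ∷ B i ∘ punchIn j) ∎
  where
  b₀ = b zero
  B₀ = B zero
  D : Vector ℚ (suc (suc n))
  D k = det λ i j → B (suc i) (punchIn k j)
  G : (Fin n → Fin (suc (suc n))) → ℚ
  G h = det λ i → b (suc i) ∷ B (suc i) ∘ h
  G-ext : Extensional G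
  G-ext {f} {g} f≗g = det-cong
    {A = λ i → b (suc i) ∷ B (suc i) ∘ f} {B = λ i → b (suc i) ∷ B (suc i) ∘ g}
    λ { i zero → refl ; i (suc j) → cong (B (suc i)) (f≗g j) }
  p q r s u : Vector ℚ (suc (suc n))
  p k = sgn k * B₀ k * D k
  q k = sgn k * B₀ k * ∑[ l < suc n ] (sgn l * c (punchIn k l) * G (punchIn k ∘ punchIn l))
  r k = sgn k * c k * D k
  s k = sgn k * c k * ∑[ l < suc n ] (sgn l * c (punchIn k l) * G (punchIn k ∘ punchIn l))
  u k = sgn k * c k * ∑[ l < suc n ] (sgn l * B₀ (punchIn k l) * G (punchIn k ∘ punchIn l))
  split : ∀ s B b c d z → s * (B - b * c) * (d - z)
    ≡ 1ℚ * (1ℚ * (s * B * d) + - 1ℚ * (s * B * z)) + (- b) * (1ℚ * (s * c * d) + - 1ℚ * (s * c * z))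
  split = solve-∀ ring
  split′ : ∀ s c b d z → s * c * (b * d - z) ≡ b * (s * c * d) + - 1ℚ * (s * c * z)
  split′ = solve-∀ ring
  tidy : ∀ d z b r → 1ℚ * (1ℚ * d + - 1ℚ * (- z)) + (- b) * (1ℚ * r + - 1ℚ * 0ℚ)
    ≡ d - (b * r + - 1ℚ * z)
  tidy = solve-∀ ring

-- One step of Gaussian elimination. The ratios `c` of the first row are supplied, so the pivot is
-- never divided by; expanding with `det-∷` gives the right side of `det-rank-one`.
det-eliminate : ∀ {n} (M : Matrix (suc n)) (c : Vector ℚ n) →
  (∀ j → M zero (suc j) ≡ M zero zero * c j) →
  det M ≡ M zero zero * det (λ i j → M (suc i) (suc j) - M (suc i) zero * c j)
det-eliminate {zero}  M c _ = base (M zero zero)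
  where
  base : ∀ p → 1ℚ * p * 1ℚ + 0ℚ ≡ p * 1ℚ
  base = solve-∀ ring
det-eliminate {suc n} M c row = begin
  det M
    ≡⟨ det-cong {A = M} {B = λ i → b i ∷ B i} (λ { i zero → refl ; i (suc j) → refl }) ⟩
  det (λ i → b i ∷ B i)
    ≡⟨ det-∷ b B ⟩
  p * det (B ∘ suc) - ∑[ l < suc n ] (sgn l * B zero l * d l)
    ≡⟨ cong (λ z → p * det (B ∘ suc) - z) (trans
         (sum-cong-≗ λ l → trans (cong (λ z → sgn l * z * d l) (row l)) (pull (sgn l) p (c l) (d l)))
         (sym (*-distribˡ-sum p (λ l → sgn l * c l * d l)))) ⟩
  p * det (B ∘ suc) - p * ∑[ l < suc n ] (sgn l * c l * d l)
    ≡⟨ factor p _ _ ⟩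
  p * (det (B ∘ suc) - ∑[ l < suc n ] (sgn l * c l * d l))
    ≡⟨ cong (p *_) (det-rank-one (B ∘ suc) (b ∘ suc) c) ⟨
  p * det (λ i j → B (suc i) j - b (suc i) * c j) ∎
  where
  p = M zero zero
  b : Vector ℚ (suc (suc n))
  b i = M i zero
  B : Fin (suc (suc n)) → Vector ℚ (suc n)
  B i j = M i (suc j)
  d : Vector ℚ (suc n)
  d l = det λ r → b (suc r) ∷ B (suc r) ∘ punchIn l
  pull : ∀ s p c d → s * (p * c) * d ≡ p * (s * c * d)
  pull = solve-∀ ring
  factor : ∀ p x y → p * x - p * y ≡ p * (x - y)
  factor = solve-∀ ring

-- Eliminating the first row and column removes exactly the term m = 0 from every entry, and what
-- remains is the same kind of product for the shifted `A` and `U`. The pivots are the diagonal of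
-- `A`, as `U` is unitriangular.
det-LU : ∀ n (A U : ℕ → ℕ → ℚ) →
  (∀ {i m} → i ℕ.< m → A i m ≡ 0ℚ) →
  (∀ {m j} → j ℕ.< m → U m j ≡ 0ℚ) → (∀ m → U m m ≡ 1ℚ) →
  det {n} (λ i j → ∑[ m < n ] (A (toℕ i) (toℕ m) * U (toℕ m) (toℕ j)))
    ≡ product {n} λ i → A (toℕ i) (toℕ i)
det-LU zero    A U A-lower U-upper U-diag = refl
det-LU (suc n) A U A-lower U-upper U-diag = begin
  det M
    ≡⟨ det-eliminate M (λ j → U 0 (suc (toℕ j)))
         (λ j → trans (first-row (suc (toℕ j))) (cong (_* U 0 (suc (toℕ j))) (sym corner))) ⟩
  M zero zero * det (λ i j → M (suc i) (suc j) - M (suc i) zero * U 0 (suc (toℕ j)))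
    ≡⟨ cong₂ _*_ corner (det-cong λ i j → trans
         (cong (λ z → M (suc i) (suc j) - z * U 0 (suc (toℕ j))) (first-column (suc (toℕ i))))
         (cancel (A (suc (toℕ i)) 0 * U 0 (suc (toℕ j))) _)) ⟩
  A 0 0 * det {n} (λ i j → ∑[ m < n ] (A′ (toℕ i) (toℕ m) * U′ (toℕ m) (toℕ j)))
    ≡⟨ cong (A 0 0 *_) (det-LU n A′ U′ (A-lower ∘ ℕ.s≤s) (U-upper ∘ ℕ.s≤s) (U-diag ∘ suc)) ⟩
  A 0 0 * product {n} (λ i → A′ (toℕ i) (toℕ i)) ∎
  where
  M : Matrix (suc n)
  M i j = ∑[ m < suc n ] (A (toℕ i) (toℕ m) * U (toℕ m) (toℕ j))
  A′ U′ : ℕ → ℕ → ℚ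
  A′ i m = A (suc i) (suc m)
  U′ m j = U (suc m) (suc j)
  first-row : ∀ j → ∑[ m < suc n ] (A 0 (toℕ m) * U (toℕ m) j) ≡ A 0 0 * U 0 j
  first-row j = trans
    (cong (A 0 0 * U 0 j +_) (∑-zero {n} λ m →
      trans (cong (_* U (suc (toℕ m)) j) (A-lower ℕ.z<s)) (*-zeroˡ (U (suc (toℕ m)) j))))
    (+-identityʳ _)
  first-column : ∀ i → ∑[ m < suc n ] (A i (toℕ m) * U (toℕ m) 0) ≡ A i 0
  first-column i = trans
    (cong₂ _+_ (trans (cong (A i 0 *_) (U-diag 0)) (*-identityʳ (A i 0))) (∑-zero {n} λ m →
      trans (cong (A i (suc (toℕ m)) *_) (U-upper ℕ.z<s)) (*-zeroʳ (A i (suc (toℕ m))))))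
    (+-identityʳ (A i 0))
  corner : M zero zero ≡ A 0 0
  corner = first-column 0
  cancel : ∀ x y → x + y - x ≡ y
  cancel = solve-∀ ring

-- Rational numbers

fromℚᵘ-homo-+ : ∀ p q → fromℚᵘ (p ℚᵘ.+ q) ≡ fromℚᵘ p + fromℚᵘ q
fromℚᵘ-homo-+ p q = toℚᵘ-injective (ℚᵘ.≃-trans (toℚᵘ-fromℚᵘ (p ℚᵘ.+ q)) (ℚᵘ.≃-sym
  (ℚᵘ.≃-trans (toℚᵘ-homo-+ (fromℚᵘ p) (fromℚᵘ q)) (ℚᵘ.+-cong (toℚᵘ-fromℚᵘ p) (toℚᵘ-fromℚᵘ q)))))

fromℚᵘ-homo-* : ∀ p q → fromℚᵘ (p ℚᵘ.* q) ≡ fromℚᵘ p * fromℚᵘ q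
fromℚᵘ-homo-* p q = toℚᵘ-injective (ℚᵘ.≃-trans (toℚᵘ-fromℚᵘ (p ℚᵘ.* q)) (ℚᵘ.≃-sym
  (ℚᵘ.≃-trans (toℚᵘ-homo-* (fromℚᵘ p) (fromℚᵘ q)) (ℚᵘ.*-cong (toℚᵘ-fromℚᵘ p) (toℚᵘ-fromℚᵘ q)))))

/1-homo-+ : ∀ x y → (x ℤ.+ y) / 1 ≡ x / 1 + y / 1
/1-homo-+ x y = trans (cong (_/ 1) (sym (cong₂ ℤ._+_ (ℤ.*-identityʳ x) (ℤ.*-identityʳ y))))
  (fromℚᵘ-homo-+ (mkℚᵘ x 0) (mkℚᵘ y 0))

/1-homo-* : ∀ x y → (x ℤ.* y) / 1 ≡ x / 1 * (y / 1)
/1-homo-* x y = fromℚᵘ-homo-* (mkℚᵘ x 0) (mkℚᵘ y 0)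

fromℕ-homo-+ : ∀ m n → fromℕ (m ℕ.+ n) ≡ fromℕ m + fromℕ n
fromℕ-homo-+ m n = /1-homo-+ (ℤ.+ m) (ℤ.+ n)

fromℕ-homo-* : ∀ m n → fromℕ (m ℕ.* n) ≡ fromℕ m * fromℕ n
fromℕ-homo-* m n = trans (cong (_/ 1) (ℤ.pos-* m n)) (/1-homo-* (ℤ.+ m) (ℤ.+ n))

fromℕ-suc : ∀ n → fromℕ (suc n) ≡ 1ℚ + fromℕ n
fromℕ-suc = fromℕ-homo-+ 1

fromℕ-*-recip : ∀ n → fromℕ (suc n) * (ℤ.+ 1 / suc n) ≡ 1ℚ
fromℕ-*-recip n = trans (sym (fromℚᵘ-homo-* p q))
  (fromℚᵘ-cong {p ℚᵘ.* q} {mkℚᵘ (ℤ.+ 1) 0} (*≡* (cong ℤ.+_ cross)))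
  where
  p = mkℚᵘ (ℤ.+ suc n) 0
  q = mkℚᵘ (ℤ.+ 1) n
  cross : suc n ℕ.* 1 ℕ.* 1 ≡ 1 ℕ.* (1 ℕ.* suc n)
  cross = trans (ℕ.*-identityʳ (suc n ℕ.* 1))
    (trans (ℕ.*-comm (suc n) 1) (sym (ℕ.*-identityˡ (1 ℕ.* suc n))))

recip!-suc : ∀ k → fromℕ (suc k) * recip! (suc k) ≡ recip! k
recip!-suc k = begin
  a * r′              ≡⟨ *-identityʳ (a * r′) ⟨
  a * r′ * 1ℚ         ≡⟨ cong (a * r′ *_) (n!*recip!≡1 k) ⟨
  a * r′ * (f * r)    ≡⟨ rearrange a r′ f r ⟩
  a * f * r′ * r      ≡⟨ cong (λ z → z * r′ * r) (fromℕ-homo-* (suc k) (k !)) ⟨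
  fromℕ (suc k !) * r′ * r ≡⟨ cong (_* r) (n!*recip!≡1 (suc k)) ⟩
  1ℚ * r              ≡⟨ *-identityˡ r ⟩
  r                   ∎
  where
  a  = fromℕ (suc k)
  f  = fromℕ (k !)
  r  = recip! k
  r′ = recip! (suc k)
  rearrange : ∀ a b c d → a * b * (c * d) ≡ a * c * b * d
  rearrange = solve-∀ ring

*-cancelˡ-inverse : ∀ a a⁻¹ x y → a⁻¹ * a ≡ 1ℚ → a * x ≡ a * y → x ≡ y
*-cancelˡ-inverse a a⁻¹ x y inv ax≡ay = trans (sym (undo x)) (trans (cong (a⁻¹ *_) ax≡ay) (undo y))
  where
  undo : ∀ z → a⁻¹ * (a * z) ≡ z
  undo z = trans (sym (*-assoc a⁻¹ a z)) (trans (cong (_* z) inv) (*-identityˡ z))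

/4≡*¼ : ∀ z → z / 4 ≡ z / 1 * (ℤ.+ 1 / 4)
/4≡*¼ z = trans (cong (_/ 4) (sym (ℤ.*-identityʳ z))) (fromℚᵘ-homo-* (mkℚᵘ z 0) (mkℚᵘ (ℤ.+ 1) 3))

-- Power series

⊛-terms : (f g : Series) (n : ℕ) → Vector ℚ (suc n)
⊛-terms f g n i = f (toℕ i) * g (n ∸ toℕ i)

⊛-cong : ∀ {f f′ g g′ : Series} → f ≗ f′ → g ≗ g′ → f ⊛ g ≗ f′ ⊛ g′
⊛-cong f≗ g≗ n = sum-cong-≗ {suc n} λ i → cong₂ _*_ (f≗ (toℕ i)) (g≗ (n ∸ toℕ i))

-- `_⊛_` unfolds by splitting off the term with `f 0`; this splits off the one with `g 0` instead.
⊛-sucʳ : ∀ (f g : Series) n → (f ⊛ g) (suc n) ≡ (f ⊛ g ∘ suc) n + f (suc n) * g 0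
⊛-sucʳ f g zero    = swap (f 0 * g 1) (f 1 * g 0)
  where
  swap : ∀ a b → a + (b + 0ℚ) ≡ a + 0ℚ + b
  swap = solve-∀ ring
⊛-sucʳ f g (suc n) = trans
  (cong (f 0 * g (suc (suc n)) +_) (⊛-sucʳ (f ∘ suc) g n))
  (sym (+-assoc (f 0 * g (suc (suc n))) _ _))

⊛-one : ∀ (f : Series) → f ⊛ one ≗ f
⊛-one f zero    = identity (f 0)
  where
  identity : ∀ a → a * 1ℚ + 0ℚ ≡ a
  identity = solve-∀ ring
⊛-one f (suc n) = trans (cong₂ _+_ (*-zeroʳ (f 0)) (⊛-one (f ∘ suc) n)) (+-identityˡ (f (suc n)))

⊛-distribˡ-⊕ : ∀ (f g h : Series) n → (f ⊛ (g ⊕ h)) n ≡ (f ⊛ g) n + (f ⊛ h) n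
⊛-distribˡ-⊕ f g h n = trans
  (sum-cong-≗ {suc n} λ i → *-distribˡ-+ (f (toℕ i)) (g (n ∸ toℕ i)) (h (n ∸ toℕ i)))
  (∑-distrib-+ {suc n} (⊛-terms f g n) (⊛-terms f h n))

-- Quotients are unique: any series that multiplies back to `f` is the result of the long division.
-- The induction follows the division, whose remainder has quotient `h ∘ suc`.
⊛-⊘ : ∀ f g h .{{_ : NonZero (g 0)}} → f ≗ h ⊛ g → f ⊘ g ≗ h
⊛-⊘ f g h f≗hg = λ { zero → head ; (suc n) → ⊛-⊘ _ g (h ∘ suc) tail n }
  where
  head : f 0 * 1/ g 0 ≡ h 0
  head = begin
    f 0 * 1/ g 0                ≡⟨ cong (_* 1/ g 0) (f≗hg 0) ⟩
    (h 0 * g 0 + 0ℚ) * 1/ g 0   ≡⟨ cong (_* 1/ g 0) (+-identityʳ (h 0 * g 0)) ⟩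
    h 0 * g 0 * 1/ g 0          ≡⟨ *-assoc (h 0) (g 0) (1/ g 0) ⟩
    h 0 * (g 0 * 1/ g 0)        ≡⟨ cong (h 0 *_) (*-inverseʳ (g 0)) ⟩
    h 0 * 1ℚ                    ≡⟨ *-identityʳ (h 0) ⟩
    h 0                         ∎
  cancel : ∀ a b → a + b - a ≡ b
  cancel = solve-∀ ring
  tail : ∀ n → f (suc n) - f 0 * 1/ g 0 * g (suc n) ≡ (h ∘ suc ⊛ g) n
  tail n = trans (cong₂ (λ x c → x - c * g (suc n)) (f≗hg (suc n)) head)
    (cancel (h 0 * g (suc n)) _)

deriv : Series → Series
deriv f k = fromℕ (suc k) * f (suc k)

-- The operator `θ` = t d/dt multiplies each coefficient by its degree, and the degree of a product
-- term splits as i + (n + 1 - i). Dropping the vanishing terms of degree 0 turns `θ` into `deriv`.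
leibniz : ∀ (f g : Series) n → deriv (f ⊛ g) n ≡ (deriv f ⊛ g) n + (f ⊛ deriv g) n
leibniz f g n = begin
  fromℕ (suc n) * (f ⊛ g) (suc n)
    ≡⟨ *-distribˡ-sum {suc (suc n)} (fromℕ (suc n)) (⊛-terms f g (suc n)) ⟩
  ∑[ i < suc (suc n) ] (fromℕ (suc n) * (f (toℕ i) * g (suc n ∸ toℕ i)))
    ≡⟨ sum-cong-≗ {suc (suc n)} (λ i → trans
         (cong (_* (f (toℕ i) * g (suc n ∸ toℕ i))) (degree i))
         (split (fromℕ (toℕ i)) (fromℕ (suc n ∸ toℕ i)) (f (toℕ i)) (g (suc n ∸ toℕ i)))) ⟩
  ∑[ i < suc (suc n) ] (θ f (toℕ i) * g (suc n ∸ toℕ i) + f (toℕ i) * θ g (suc n ∸ toℕ i))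
    ≡⟨ ∑-distrib-+ {suc (suc n)} (⊛-terms (θ f) g (suc n)) (⊛-terms f (θ g) (suc n)) ⟩
  (θ f ⊛ g) (suc n) + (f ⊛ θ g) (suc n)
    ≡⟨ cong ((θ f ⊛ g) (suc n) +_) (⊛-sucʳ f (θ g) n) ⟩
  0ℚ * f 0 * g (suc n) + (deriv f ⊛ g) n + ((f ⊛ deriv g) n + f (suc n) * (0ℚ * g 0))
    ≡⟨ tidy (f 0) (g (suc n)) (f (suc n)) (g 0) _ _ ⟩
  (deriv f ⊛ g) n + (f ⊛ deriv g) n ∎
  where
  θ : Series → Series
  θ h k = fromℕ k * h k
  degree : ∀ (i : Fin (suc (suc n))) → fromℕ (suc n) ≡ fromℕ (toℕ i) + fromℕ (suc n ∸ toℕ i)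
  degree i = trans (cong fromℕ (sym (ℕ.m+[n∸m]≡n (toℕ≤pred[n] i))))
    (fromℕ-homo-+ (toℕ i) (suc n ∸ toℕ i))
  split : ∀ a b x y → (a + b) * (x * y) ≡ a * x * y + x * (b * y)
  split = solve-∀ ring
  tidy : ∀ a b c d x y → 0ℚ * a * b + x + (y + c * (0ℚ * d)) ≡ x + y
  tidy = solve-∀ ring

egf : (ℕ → ℚ) → Series
egf u k = u k * recip! k

deriv-egf : ∀ u → deriv (egf u) ≗ egf (u ∘ suc)
deriv-egf u k = trans (swap (fromℕ (suc k)) (u (suc k)) (recip! (suc k)))
  (cong (u (suc k) *_) (recip!-suc k))
  where
  swap : ∀ a b c → a * (b * c) ≡ b * (a * c)
  swap = solve-∀ ring

-- The factor e^t acts on the exponential generating function of u.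
e^t*_ : (ℕ → ℚ) → Series
e^t* u = egf u ⊛ recip!

-- Product rule: on the sequences d/dt is the shift, and `recip!`, the series of e^t, is its own
-- derivative.
deriv-e^t* : ∀ u n → deriv (e^t* u) n ≡ (e^t* λ k → u (suc k) + u k) n
deriv-e^t* u n = begin
  deriv (e^t* u) n
    ≡⟨ leibniz (egf u) recip! n ⟩
  (deriv (egf u) ⊛ recip!) n + (egf u ⊛ deriv recip!) n
    ≡⟨ cong₂ _+_ (⊛-cong {g = recip!} (deriv-egf u) (λ _ → refl) n) (⊛-cong {egf u} (λ _ → refl) recip!-suc n) ⟩
  (egf (u ∘ suc) ⊛ recip!) n + (egf u ⊛ recip!) n
    ≡⟨ ∑-distrib-+ {suc n} (⊛-terms (egf (u ∘ suc)) recip! n) (⊛-terms (egf u) recip! n) ⟨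
  ∑[ i < suc n ] (egf (u ∘ suc) (toℕ i) * recip! (n ∸ toℕ i) + egf u (toℕ i) * recip! (n ∸ toℕ i))
    ≡⟨ sum-cong-≗ {suc n} (λ i → factor (u (suc (toℕ i))) (u (toℕ i)) (recip! (toℕ i)) (recip! (n ∸ toℕ i))) ⟩
  (e^t* λ k → u (suc k) + u k) n ∎
  where
  factor : ∀ a b c d → a * c * d + b * c * d ≡ (a + b) * c * d
  factor = solve-∀ ring

e^t*-linear : ∀ a b c u v w n → (e^t* λ k → a * u k + b * v k + c * w k) n
  ≡ a * (e^t* u) n + b * (e^t* v) n + c * (e^t* w) n
e^t*-linear a b c u v w n = begin
  (e^t* λ k → a * u k + b * v k + c * w k) n
    ≡⟨ sum-cong-≗ {suc n} (λ i → rearrange a b c (u (toℕ i)) (v (toℕ i)) (w (toℕ i)) (recip! (toℕ i)) (recip! (n ∸ toℕ i))) ⟩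
  ∑[ i < suc n ] (1ℚ * (a * t u i + b * t v i) + c * t w i)
    ≡⟨ ∑-linear {suc n} 1ℚ c (λ i → a * t u i + b * t v i) (t w) ⟩
  1ℚ * ∑[ i < suc n ] (a * t u i + b * t v i) + c * (e^t* w) n
    ≡⟨ cong (_+ c * (e^t* w) n) (trans (*-identityˡ _) (∑-linear {suc n} a b (t u) (t v))) ⟩
  a * (e^t* u) n + b * (e^t* v) n + c * (e^t* w) n ∎
  where
  t : (ℕ → ℚ) → Vector ℚ (suc n)
  t u = ⊛-terms (egf u) recip! n
  rearrange : ∀ a b c x y z r s → (a * x + b * y + c * z) * r * s
    ≡ 1ℚ * (a * (x * r * s) + b * (y * r * s)) + c * (z * r * s)
  rearrange = solve-∀ ring

-- Powers of tanh(t/2)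

-- n! [tⁿ] tanh(t/2)^m.  At m = 0 the factor fromℕ m annihilates the junk value T n (pred m).
T : ℕ → ℕ → ℚ
T zero    zero    = 1ℚ
T zero    (suc m) = 0ℚ
T (suc n) m       = ½ * fromℕ m * (T n (pred m) - T n (suc m))

-- Only at m = 0 does `suc (pred m)` differ from `m`, and there the factor annihilates both sides.
T-suc-pred : ∀ n m → fromℕ m * T n (suc (pred m)) ≡ fromℕ m * T n m
T-suc-pred n zero    = trans (*-zeroˡ (T n 1)) (sym (*-zeroˡ (T n 0)))
T-suc-pred n (suc m) = refl

-- The identity e^t (1 - z) z^m = (1 + z) z^m: both sides satisfy the same recurrence in n.
e^t*[1-z]z^m : ∀ n m → (e^t* λ k → T k m - T k (suc m)) n ≡ recip! n * (T n m + T n (suc m))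
e^t*[1-z]z^m zero    m = base (T 0 m)
  where
  base : ∀ x → (x - 0ℚ) * 1ℚ * 1ℚ + 0ℚ ≡ 1ℚ * (x + 0ℚ)
  base = solve-∀ ring
-- Multiplying by n + 1 turns the coefficient at n + 1 into the coefficient at n of the derivative.
e^t*[1-z]z^m (suc n) m = *-cancelˡ-inverse (fromℕ (suc n)) (ℤ.+ 1 / suc n) _ _
  (trans (*-comm (ℤ.+ 1 / suc n) (fromℕ (suc n))) (fromℕ-*-recip n)) (begin
  deriv (e^t* u m) n
    ≡⟨ deriv-e^t* (u m) n ⟩
  (e^t* λ k → u m (suc k) + u m k) n
    ≡⟨ sum-cong-≗ {suc n} (λ i → cong (λ z → z * recip! (toℕ i) * recip! (n ∸ toℕ i)) (u-rec (toℕ i))) ⟩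
  (e^t* λ k → ½ * x * u (pred m) k + ½ * u m k + (- (½ * (1ℚ + x))) * u (suc m) k) n
    ≡⟨ e^t*-linear (½ * x) ½ (- (½ * (1ℚ + x))) (u (pred m)) (u m) (u (suc m)) n ⟩
  ½ * x * (e^t* u (pred m)) n + ½ * (e^t* u m) n + (- (½ * (1ℚ + x))) * (e^t* u (suc m)) n
    ≡⟨ cong₃ (λ a b c → ½ * x * a + ½ * b + (- (½ * (1ℚ + x))) * c)
         (e^t*[1-z]z^m n (pred m)) (e^t*[1-z]z^m n m) (e^t*[1-z]z^m n (suc m)) ⟩
  ½ * x * (r * s (pred m)) + ½ * (r * s m) + (- (½ * (1ℚ + x))) * (r * s (suc m))
    ≡⟨ factor x r (s (pred m)) (s m) (s (suc m)) ⟩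
  r * (½ * x * s (pred m) + ½ * s m + (- (½ * (1ℚ + x))) * s (suc m))
    ≡⟨ cong (r *_) s-rec ⟨
  r * (T (suc n) m + T (suc n) (suc m))
    ≡⟨ cong (_* (T (suc n) m + T (suc n) (suc m))) (recip!-suc n) ⟨
  fromℕ (suc n) * recip! (suc n) * (T (suc n) m + T (suc n) (suc m))
    ≡⟨ *-assoc (fromℕ (suc n)) (recip! (suc n)) _ ⟩
  fromℕ (suc n) * (recip! (suc n) * (T (suc n) m + T (suc n) (suc m))) ∎)
  where
  x = fromℕ m
  r = recip! n
  u : ℕ → ℕ → ℚ
  u m k = T k m - T k (suc m)
  s : ℕ → ℚ
  s m = T n m + T n (suc m)
  cong₃ : ∀ (f : ℚ → ℚ → ℚ → ℚ) {a a′ b b′ c c′} → a ≡ a′ → b ≡ b′ → c ≡ c′ → f a b c ≡ f a′ b′ c′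
  cong₃ f refl refl refl = refl
  factor : ∀ x r a b c → ½ * x * (r * a) + ½ * (r * b) + (- (½ * (1ℚ + x))) * (r * c)
    ≡ r * (½ * x * a + ½ * b + (- (½ * (1ℚ + x))) * c)
  factor = solve-∀ ring
  -- From z′ = (1 - z²)/2: the derivative of (1 - z) z^m plus the series itself, and the derivative
  -- of (1 + z) z^m, have the same coefficients m/2, 1/2, -(m+1)/2 on the series with exponents m -
  -- 1, m, m + 1.
  u-rec : ∀ k → u m (suc k) + u m k
    ≡ ½ * x * u (pred m) k + ½ * u m k + (- (½ * (1ℚ + x))) * u (suc m) k
  u-rec k = begin
    ½ * x * (a - c) - ½ * fromℕ (suc m) * (b - d) + (b - c)
      ≡⟨ cong (λ z → ½ * x * (a - c) - ½ * z * (b - d) + (b - c)) (fromℕ-suc m) ⟩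
    ½ * x * (a - c) - ½ * (1ℚ + x) * (b - d) + (b - c)
      ≡⟨ alg₁ x a b c d ⟩
    ½ * (x * a - x * b) + ½ * (b - c) + (- (½ * (1ℚ + x))) * (c - d)
      ≡⟨ cong (λ z → ½ * (x * a - z) + ½ * (b - c) + (- (½ * (1ℚ + x))) * (c - d)) (T-suc-pred k m) ⟨
    ½ * (x * a - x * b′) + ½ * (b - c) + (- (½ * (1ℚ + x))) * (c - d)
      ≡⟨ alg₂ x a b b′ c d ⟩
    ½ * x * (a - b′) + ½ * (b - c) + (- (½ * (1ℚ + x))) * (c - d) ∎
    where
    a = T k (pred m)
    b = T k m
    b′ = T k (suc (pred m))
    c = T k (suc m)
    d = T k (suc (suc m))
    alg₁ : ∀ x a b c d → ½ * x * (a - c) - ½ * (1ℚ + x) * (b - d) + (b - c)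
      ≡ ½ * (x * a - x * b) + ½ * (b - c) + (- (½ * (1ℚ + x))) * (c - d)
    alg₁ = solve-∀ ring
    alg₂ : ∀ x a b b′ c d → ½ * (x * a - x * b′) + ½ * (b - c) + (- (½ * (1ℚ + x))) * (c - d)
      ≡ ½ * x * (a - b′) + ½ * (b - c) + (- (½ * (1ℚ + x))) * (c - d)
    alg₂ = solve-∀ ring
  s-rec : T (suc n) m + T (suc n) (suc m)
    ≡ ½ * x * s (pred m) + ½ * s m + (- (½ * (1ℚ + x))) * s (suc m)
  s-rec = begin
    ½ * x * (a - c) + ½ * fromℕ (suc m) * (b - d)
      ≡⟨ cong (λ z → ½ * x * (a - c) + ½ * z * (b - d)) (fromℕ-suc m) ⟩
    ½ * x * (a - c) + ½ * (1ℚ + x) * (b - d)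
      ≡⟨ alg₁ x a b c d ⟩
    ½ * (x * a + x * b) + ½ * (b + c) + (- (½ * (1ℚ + x))) * (c + d)
      ≡⟨ cong (λ z → ½ * (x * a + z) + ½ * (b + c) + (- (½ * (1ℚ + x))) * (c + d)) (T-suc-pred n m) ⟨
    ½ * (x * a + x * b′) + ½ * (b + c) + (- (½ * (1ℚ + x))) * (c + d)
      ≡⟨ alg₂ x a b b′ c d ⟩
    ½ * x * (a + b′) + ½ * (b + c) + (- (½ * (1ℚ + x))) * (c + d) ∎
    where
    a = T n (pred m)
    b = T n m
    b′ = T n (suc (pred m))
    c = T n (suc m)
    d = T n (suc (suc m))
    alg₁ : ∀ x a b c d → ½ * x * (a - c) + ½ * (1ℚ + x) * (b - d)
      ≡ ½ * (x * a + x * b) + ½ * (b + c) + (- (½ * (1ℚ + x))) * (c + d)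
    alg₁ = solve-∀ ring
    alg₂ : ∀ x a b b′ c d → ½ * (x * a + x * b′) + ½ * (b + c) + (- (½ * (1ℚ + x))) * (c + d)
      ≡ ½ * x * (a + b′) + ½ * (b + c) + (- (½ * (1ℚ + x))) * (c + d)
    alg₂ = solve-∀ ring

-- The Euler polynomials at 1

1^n≡1 : ∀ n → 1ℚ ^ n ≡ 1ℚ
1^n≡1 zero    = refl
1^n≡1 (suc n) = trans (*-identityˡ (1ℚ ^ n)) (1^n≡1 n)

exp1≗recip! : exp 1ℚ ≗ recip!
exp1≗recip! n = trans (cong (_* recip! n) (1^n≡1 n)) (*-identityˡ (recip! n))

-- It suffices to multiply 1 + z by e^t + 1: since 1 + z = e^t (1 - z), the product is e^t (1 + z) +
-- e^t (1 - z) = 2e^t.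
E≡T₀+T₁ : ∀ n → E n 1ℚ ≡ T n 0 + T n 1
E≡T₀+T₁ n = begin
  fromℕ (n !) * ((fromℕ 2 · exp 1ℚ) ⊘ (exp 1ℚ ⊕ one)) n
    ≡⟨ cong (fromℕ (n !) *_) (⊛-⊘ (fromℕ 2 · exp 1ℚ) (exp 1ℚ ⊕ one) (egf y) (sym ∘ gf) n) ⟩
  fromℕ (n !) * (y n * recip! n)
    ≡⟨ swap (fromℕ (n !)) (y n) (recip! n) ⟩
  y n * (fromℕ (n !) * recip! n)
    ≡⟨ cong (y n *_) (n!*recip!≡1 n) ⟩
  y n * 1ℚ
    ≡⟨ *-identityʳ (y n) ⟩
  y n ∎
  where
  y : ℕ → ℚ
  y k = T k 0 + T k 1
  swap : ∀ a b c → a * (b * c) ≡ b * (a * c)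
  swap = solve-∀ ring
  T₀ : ∀ k → egf (λ k → T k 0) k ≡ one k
  T₀ zero    = refl
  T₀ (suc k) = vanish (T k 0 - T k 1) (recip! (suc k))
    where
    vanish : ∀ a r → ½ * 0ℚ * a * r ≡ 0ℚ
    vanish = solve-∀ ring
  gf : egf y ⊛ (exp 1ℚ ⊕ one) ≗ fromℕ 2 · exp 1ℚ
  gf n = begin
    (egf y ⊛ (exp 1ℚ ⊕ one)) n
      ≡⟨ ⊛-distribˡ-⊕ (egf y) (exp 1ℚ) one n ⟩
    (egf y ⊛ exp 1ℚ) n + (egf y ⊛ one) n
      ≡⟨ cong₂ _+_ (⊛-cong {egf y} (λ _ → refl) exp1≗recip! n) (⊛-one (egf y) n) ⟩
    (e^t* y) n + y n * recip! n
      ≡⟨ cong ((e^t* y) n +_) (trans (*-comm (y n) (recip! n)) (sym (e^t*[1-z]z^m n 0))) ⟩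
    (e^t* y) n + (e^t* w) n
      ≡⟨ ∑-distrib-+ {suc n} (⊛-terms (egf y) recip! n) (⊛-terms (egf w) recip! n) ⟨
    ∑[ i < suc n ] (egf y (toℕ i) * recip! (n ∸ toℕ i) + egf w (toℕ i) * recip! (n ∸ toℕ i))
      ≡⟨ sum-cong-≗ {suc n} (λ i → trans
           (double (T (toℕ i) 0) (T (toℕ i) 1) (recip! (toℕ i)) (recip! (n ∸ toℕ i)))
           (cong (λ z → fromℕ 2 * (z * recip! (n ∸ toℕ i))) (T₀ (toℕ i)))) ⟩
    ∑[ i < suc n ] (fromℕ 2 * (one (toℕ i) * recip! (n ∸ toℕ i)))
      ≡⟨ *-distribˡ-sum {suc n} (fromℕ 2) (λ i → one (toℕ i) * recip! (n ∸ toℕ i)) ⟨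
    fromℕ 2 * (1ℚ * recip! n + ∑[ i < n ] (0ℚ * recip! (n ∸ suc (toℕ i))))
      ≡⟨ cong (fromℕ 2 *_) (trans
           (cong₂ _+_ (*-identityˡ (recip! n)) (∑-zero {n} λ i → *-zeroˡ (recip! (n ∸ suc (toℕ i)))))
           (+-identityʳ (recip! n))) ⟩
    fromℕ 2 * recip! n
      ≡⟨ cong (fromℕ 2 *_) (exp1≗recip! n) ⟨
    fromℕ 2 * exp 1ℚ n ∎
    where
    w : ℕ → ℚ
    w k = T k 0 - T k 1
    double : ∀ a b r s → (a + b) * r * s + (a - b) * r * s ≡ fromℕ 2 * (a * r * s)
    double = solve-∀ ring

-- The Hankel form

-- Unlike 2 * n, it lets T unfold at double (suc n).
double : ℕ → ℕ
double zero    = zero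
double (suc n) = suc (suc (double n))

double≡2* : ∀ n → double n ≡ 2 ℕ.* n
double≡2* zero    = refl
double≡2* (suc n) = cong suc (trans (cong suc (double≡2* n)) (sym (ℕ.+-suc n (n ℕ.+ 0))))

double-mono-< : ∀ {m n} → m ℕ.< n → double m ℕ.< double n
double-mono-< {zero}  {suc n} _         = ℕ.z<s
double-mono-< {suc m} {suc n} (ℕ.s≤s m<n) = ℕ.s≤s (ℕ.s≤s (double-mono-< m<n))

-- The series tanh(t/2) has no constant term, so its m-th power starts at t^m.
T-upper : ∀ {n m} → n ℕ.< m → T n m ≡ 0ℚ
T-upper {zero}  {suc m} _           = refl
T-upper {suc n} {suc m} (ℕ.s≤s n<m) = trans
  (cong₂ (λ a b → ½ * fromℕ (suc m) * (a - b)) (T-upper n<m) (T-upper (ℕ.m<n⇒m<1+n (ℕ.m<n⇒m<1+n n<m))))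
  (*-zeroʳ (½ * fromℕ (suc m)))

T-suc-0 : ∀ n → T (suc n) 0 ≡ 0ℚ
T-suc-0 n = vanish (T n 0 - T n 1)
  where
  vanish : ∀ a → ½ * 0ℚ * a ≡ 0ℚ
  vanish = solve-∀ ring

odd : ℕ → ℚ
odd p = fromℕ (suc (double p))

-- The powers of tanh(t/2) with odd and with even exponent, at degrees of the same parity. The
-- recurrence of `T` alternates between them: by computation `V p i` is `½ * odd p * ΔW p i`, and
-- `W (suc p) (suc i)` is `½ * fromℕ (double (suc p)) * ΔV p i`.
V W ΔV ΔW : ℕ → ℕ → ℚ
V p i = T (suc (double i)) (suc (double p))
W p i = T (double i) (double p)
ΔV p i = V p i - V (suc p) i
ΔW p i = W p i - W (suc p) i

V-upper : ∀ {p i} → i ℕ.< p → V p i ≡ 0ℚ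
V-upper i<p = T-upper (ℕ.s≤s (double-mono-< i<p))

W-upper : ∀ {p i} → i ℕ.< p → W p i ≡ 0ℚ
W-upper i<p = T-upper (double-mono-< i<p)

-- As V p i = ½ * odd p * ΔW p i, this is ∑ 4/(2p+1) V p i V p j.
C : ℕ → ℕ → ℕ → ℚ
C N i j = ∑[ p < N ] (odd (toℕ p) * (ΔW (toℕ p) i * ΔW (toℕ p) j))

C-comm : ∀ N i j → C N i j ≡ C N j i
C-comm N i j = sum-cong-≗ {N} λ p → cong (odd (toℕ p) *_) (*-comm (ΔW (toℕ p) i) (ΔW (toℕ p) j))

-- The counterpart of `C` with the parities exchanged, that is ∑ 4/(2p+2) `W (suc p) (suc i)`
-- `W (suc p) (suc j)`.
K : ℕ → ℕ → ℕ → ℚ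
K N i j = ∑[ p < N ] (fromℕ (double (suc (toℕ p))) * (ΔV (toℕ p) i * ΔV (toℕ p) j))

K-comm : ∀ N i j → K N i j ≡ K N j i
K-comm N i j = sum-cong-≗ {N} λ p →
  cong (fromℕ (double (suc (toℕ p))) *_) (*-comm (ΔV (toℕ p) i) (ΔV (toℕ p) j))

-- Summation by parts. The left sum is 2 ∑ `ΔW p (suc i)` `V p j`; moving the difference onto `V`
-- gives the boundary term at `N`, while the one at 0 vanishes because `W 0 (suc i)` does.
C-suc : ∀ N i j → C N (suc i) j + fromℕ 2 * (W N (suc i) * V N j) ≡ - K N i j
C-suc zero i j = trans (cong (λ z → 0ℚ + fromℕ 2 * (z * V 0 j)) (T-suc-0 (suc (double i)))) (base (V 0 j))
  where
  base : ∀ a → 0ℚ + fromℕ 2 * (0ℚ * a) ≡ - 0ℚ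
  base = solve-∀ ring
C-suc (suc N) i j = begin
  C (suc N) (suc i) j + fromℕ 2 * (W (suc N) (suc i) * V (suc N) j)
    ≡⟨ cong (_+ fromℕ 2 * (W (suc N) (suc i) * V (suc N) j))
         (∑-last N λ p → odd p * (ΔW p (suc i) * ΔW p j)) ⟩
  C N (suc i) j + odd N * (ΔW N (suc i) * ΔW N j) + fromℕ 2 * (W (suc N) (suc i) * V (suc N) j)
    -- `W (suc N) (suc i)` and `V N j` unfold by the recurrence of `T`, which reduces the step to a
    -- polynomial identity.
    ≡⟨ step (C N (suc i) j) (odd N) (W N (suc i)) (W N j) (W (suc N) j)
            (fromℕ (double (suc N))) (V N i) (V (suc N) i) (V (suc N) j) ⟩
  C N (suc i) j + fromℕ 2 * (W N (suc i) * V N j) - fromℕ (double (suc N)) * (ΔV N i * ΔV N j)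
    ≡⟨ cong (_- fromℕ (double (suc N)) * (ΔV N i * ΔV N j)) (C-suc N i j) ⟩
  - K N i j - fromℕ (double (suc N)) * (ΔV N i * ΔV N j)
    ≡⟨ neg-distrib-+ (K N i j) _ ⟨
  - (K N i j + fromℕ (double (suc N)) * (ΔV N i * ΔV N j))
    ≡⟨ cong -_ (∑-last N λ p → fromℕ (double (suc p)) * (ΔV p i * ΔV p j)) ⟨
  - K (suc N) i j ∎
  where
  step : ∀ C o a c d e v v′ y′ →
    C + o * ((a - ½ * e * (v - v′)) * (c - d)) + fromℕ 2 * (½ * e * (v - v′) * y′)
    ≡ C + fromℕ 2 * (a * (½ * o * (c - d))) - e * ((v - v′) * (½ * o * (c - d) - y′))
  step = solve-∀ ring

-- `K` is symmetric, so `C-suc` may be applied with either index raised. The bound on `j` makes both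
-- boundary terms zero.
C-shift : ∀ N i j → suc j ℕ.< N → C N i (suc j) ≡ C N (suc i) j
C-shift N i j j+1<N = begin
  C N i (suc j)
    ≡⟨ C-comm N i (suc j) ⟩
  C N (suc j) i
    ≡⟨ zero₁ (C N (suc j) i) (V N i) ⟨
  C N (suc j) i + fromℕ 2 * (0ℚ * V N i)
    ≡⟨ cong (λ z → C N (suc j) i + fromℕ 2 * (z * V N i)) (W-upper j+1<N) ⟨
  C N (suc j) i + fromℕ 2 * (W N (suc j) * V N i)
    ≡⟨ trans (C-suc N j i) (trans (cong -_ (K-comm N j i)) (sym (C-suc N i j))) ⟩
  C N (suc i) j + fromℕ 2 * (W N (suc i) * V N j)
    ≡⟨ cong (λ z → C N (suc i) j + fromℕ 2 * (W N (suc i) * z)) (V-upper (ℕ.<-trans (ℕ.n<1+n j) j+1<N)) ⟩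
  C N (suc i) j + fromℕ 2 * (W N (suc i) * 0ℚ)
    ≡⟨ zero₂ (C N (suc i) j) (W N (suc i)) ⟩
  C N (suc i) j ∎
  where
  zero₁ : ∀ c v → c + fromℕ 2 * (0ℚ * v) ≡ c
  zero₁ = solve-∀ ring
  zero₂ : ∀ c w → c + fromℕ 2 * (w * 0ℚ) ≡ c
  zero₂ = solve-∀ ring

-- `C-shift` moves `j` over to `i` one unit at a time. At j = 0 only the summand p = 0 survives, as
-- `W p 0` is 1 for p = 0 and 0 otherwise, and it is the recurrence for `V 0 i`.
V₀-Hankel : ∀ N i j → j ℕ.< N → V 0 (i ℕ.+ j) ≡ ½ * C N i j
V₀-Hankel (suc N) i zero _ = begin
  V 0 (i ℕ.+ 0)
    ≡⟨ cong (V 0) (ℕ.+-identityʳ i) ⟩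
  ½ * odd 0 * ΔW 0 i
    ≡⟨ base (odd 0) (ΔW 0 i) ⟨
  ½ * (odd 0 * (ΔW 0 i * (1ℚ - 0ℚ)) + 0ℚ)
    ≡⟨ cong (λ z → ½ * (odd 0 * (ΔW 0 i * (1ℚ - 0ℚ)) + z)) (∑-zero {N} λ p →
         vanish (odd (suc (toℕ p))) (ΔW (suc (toℕ p)) i)) ⟨
  ½ * C (suc N) i 0 ∎
  where
  base : ∀ o a → ½ * (o * (a * (1ℚ - 0ℚ)) + 0ℚ) ≡ ½ * o * a
  base = solve-∀ ring
  vanish : ∀ o a → o * (a * (0ℚ - 0ℚ)) ≡ 0ℚ
  vanish = solve-∀ ring
V₀-Hankel N i (suc j) j+1<N = begin
  V 0 (i ℕ.+ suc j)   ≡⟨ cong (V 0) (ℕ.+-suc i j) ⟩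
  V 0 (suc i ℕ.+ j)   ≡⟨ V₀-Hankel N (suc i) j (ℕ.<-trans (ℕ.n<1+n j) j+1<N) ⟩
  ½ * C N (suc i) j   ≡⟨ cong (½ *_) (C-shift N i j j+1<N) ⟨
  ½ * C N i (suc j)   ∎

-- Here 2k + 5 = 2(k + 2) + 1. For k = i + j the shift by 2 is shared by the two indices, hence
-- `suc i` and `suc j` in what follows.
E-odd : ∀ k → E (2 ℕ.* k ℕ.+ 5) 1ℚ ≡ V 0 (suc (suc k))
E-odd k = begin
  E (2 ℕ.* k ℕ.+ 5) 1ℚ
    ≡⟨ cong (λ m → E m 1ℚ) (trans (ℕ.+-comm (2 ℕ.* k) 5) (cong (5 ℕ.+_) (sym (double≡2* k)))) ⟩
  E m 1ℚ
    ≡⟨ E≡T₀+T₁ m ⟩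
  T m 0 + V 0 (suc (suc k))
    ≡⟨ cong (_+ V 0 (suc (suc k))) (T-suc-0 (double (suc (suc k)))) ⟩
  0ℚ + V 0 (suc (suc k))
    ≡⟨ +-identityˡ (V 0 (suc (suc k))) ⟩
  V 0 (suc (suc k)) ∎
  where m = suc (double (suc (suc k)))

-- Sums of odd reciprocals and completing squares

H̅-suc : ∀ p → H̅ (suc p) ≡ H̅ p + ℤ.+ 1 / suc (2 ℕ.* suc p)
H̅-suc p = ∑-last (suc p) λ j → ℤ.+ 1 / suc (2 ℕ.* j)

H̅-pos : ∀ p → Positive (H̅ p)
H̅-pos zero    = _
H̅-pos (suc p) = subst Positive (sym (H̅-suc p))
  (pos+pos⇒pos (H̅ p) {{H̅-pos p}} (ℤ.+ 1 / suc (2 ℕ.* suc p)) {{normalize-pos 1 (suc (2 ℕ.* suc p))}})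

H̅⁻¹ : ℕ → ℚ
H̅⁻¹ p = (1/ H̅ p) {{pos⇒nonZero (H̅ p) {{H̅-pos p}}}}

H̅-inverse : ∀ p → H̅ p * H̅⁻¹ p ≡ 1ℚ
H̅-inverse p = *-inverseʳ (H̅ p) {{pos⇒nonZero (H̅ p) {{H̅-pos p}}}}

-- The recursion of `H̅` cleared of its denominator, the form in which `complete-square` uses it.
odd-H̅ : ∀ p → odd (suc p) * H̅ (suc p) ≡ odd (suc p) * H̅ p + 1ℚ
odd-H̅ p = begin
  odd (suc p) * H̅ (suc p)
    ≡⟨ cong (odd (suc p) *_) (H̅-suc p) ⟩
  odd (suc p) * (H̅ p + ℤ.+ 1 / suc (2 ℕ.* suc p))
    ≡⟨ *-distribˡ-+ (odd (suc p)) (H̅ p) _ ⟩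
  odd (suc p) * H̅ p + odd (suc p) * (ℤ.+ 1 / suc (2 ℕ.* suc p))
    ≡⟨ cong (odd (suc p) * H̅ p +_) (trans
         (cong (λ n → fromℕ (suc n) * (ℤ.+ 1 / suc (2 ℕ.* suc p))) (double≡2* (suc p)))
         (fromℕ-*-recip (2 ℕ.* suc p))) ⟩
  odd (suc p) * H̅ p + 1ℚ ∎

-- The linear form whose square is split off when w_{p+1} is eliminated, evaluated at index i.
L : ℕ → ℕ → ℚ
L p i = W (suc p) (suc i) - H̅ p * H̅⁻¹ (suc p) * W (suc (suc p)) (suc i)

-- By `odd-H̅` this is `odd (suc p) + H̅⁻¹ p`: the coefficient left over on the square of w_{p+1}
-- plus that of the next link.
pivot : ℕ → ℚ
pivot p = odd (suc p) * H̅ (suc p) * H̅⁻¹ p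

-- Each step adds a link and completes the square in `W (suc N)`. The coefficient passed on to
-- `W (suc (suc N))` is 1/(`H̅ N` + 1/(2N+3)), which is `H̅⁻¹ (suc N)`.
C-diagonalised : ∀ N i j → C (suc N) (suc i) (suc j)
  ≡ ∑[ p < N ] (pivot (toℕ p) * (L (toℕ p) i * L (toℕ p) j))
    + H̅⁻¹ N * (W (suc N) (suc i) * W (suc N) (suc j))
C-diagonalised zero i j = trans
  -- The first link ends at w_0, which vanishes at positive indices, so it is already a pure square
  -- with coefficient 1.
  (cong₂ (λ a b → odd 0 * ((a - W 1 (suc i)) * (b - W 1 (suc j))) + 0ℚ)
    (T-suc-0 (suc (double i))) (T-suc-0 (suc (double j))))
  (base (W 1 (suc i)) (W 1 (suc j)))
  where
  base : ∀ a b → 1ℚ * ((0ℚ - a) * (0ℚ - b)) + 0ℚ ≡ 0ℚ + 1ℚ * (a * b)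
  base = solve-∀ ring
C-diagonalised (suc N) i j = begin
  C (suc (suc N)) (suc i) (suc j)
    ≡⟨ ∑-last (suc N) (λ p → odd p * (ΔW p (suc i) * ΔW p (suc j))) ⟩
  C (suc N) (suc i) (suc j) + s * ((x - y) * (x′ - y′))
    ≡⟨ cong (_+ s * ((x - y) * (x′ - y′))) (C-diagonalised N i j) ⟩
  S + a⁻¹ * (x * x′) + s * ((x - y) * (x′ - y′))
    ≡⟨ +-assoc S _ _ ⟩
  S + (a⁻¹ * (x * x′) + s * ((x - y) * (x′ - y′)))
    ≡⟨ cong (S +_) (complete-square s a b a⁻¹ b⁻¹ x y x′ y′
         (H̅-inverse N) (H̅-inverse (suc N)) (odd-H̅ N)) ⟩
  S + (pivot N * (L N i * L N j) + b⁻¹ * (y * y′))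
    ≡⟨ +-assoc S _ _ ⟨
  S + pivot N * (L N i * L N j) + b⁻¹ * (y * y′)
    ≡⟨ cong (_+ b⁻¹ * (y * y′)) (∑-last N λ p → pivot p * (L p i * L p j)) ⟨
  ∑[ p < suc N ] (pivot (toℕ p) * (L (toℕ p) i * L (toℕ p) j)) + b⁻¹ * (y * y′) ∎
  where
  S = ∑[ p < N ] (pivot (toℕ p) * (L (toℕ p) i * L (toℕ p) j))
  s = odd (suc N)
  a = H̅ N
  b = H̅ (suc N)
  a⁻¹ = H̅⁻¹ N
  b⁻¹ = H̅⁻¹ (suc N)
  x = W (suc N) (suc i)
  y = W (suc (suc N)) (suc i)
  x′ = W (suc N) (suc j)
  y′ = W (suc (suc N)) (suc j)
  complete-square : ∀ s a b a⁻¹ b⁻¹ x y x′ y′ →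
    a * a⁻¹ ≡ 1ℚ → b * b⁻¹ ≡ 1ℚ → s * b ≡ s * a + 1ℚ →
    a⁻¹ * (x * x′) + s * ((x - y) * (x′ - y′))
      ≡ s * b * a⁻¹ * ((x - a * b⁻¹ * y) * (x′ - a * b⁻¹ * y′)) + b⁻¹ * (y * y′)
  complete-square s a b a⁻¹ b⁻¹ x y x′ y′ aa⁻¹≡1 bb⁻¹≡1 sb≡sa+1 = sym (begin
    s * b * a⁻¹ * ((x - a * b⁻¹ * y) * (x′ - a * b⁻¹ * y′)) + b⁻¹ * (y * y′)
      ≡⟨ collect s a b a⁻¹ b⁻¹ x y x′ y′ ⟩
    s * b * a⁻¹ * (x * x′) - s * (a * a⁻¹) * (b * b⁻¹) * (x * y′ + y * x′)
      + (s * (a * a⁻¹) * (b * b⁻¹) * (a * b⁻¹) + b⁻¹) * (y * y′)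
      ≡⟨ cong₂ (λ u v → s * b * a⁻¹ * (x * x′) - s * u * v * (x * y′ + y * x′)
           + (s * u * v * (a * b⁻¹) + b⁻¹) * (y * y′)) aa⁻¹≡1 bb⁻¹≡1 ⟩
    s * b * a⁻¹ * (x * x′) - s * 1ℚ * 1ℚ * (x * y′ + y * x′)
      + (s * 1ℚ * 1ℚ * (a * b⁻¹) + b⁻¹) * (y * y′)
      ≡⟨ regroup (s * b) s a a⁻¹ b⁻¹ x y x′ y′ ⟩
    s * b * a⁻¹ * (x * x′) - s * (x * y′ + y * x′) + (s * a + 1ℚ) * b⁻¹ * (y * y′)
      -- The relation is read forwards in the coefficient of x x′ and backwards in that of y y′, so
      -- that `a⁻¹` meets `a` and `b⁻¹` meets `b`.
      ≡⟨ cong₂ (λ u v → u * a⁻¹ * (x * x′) - s * (x * y′ + y * x′) + v * b⁻¹ * (y * y′))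
           sb≡sa+1 (sym sb≡sa+1) ⟩
    (s * a + 1ℚ) * a⁻¹ * (x * x′) - s * (x * y′ + y * x′) + s * b * b⁻¹ * (y * y′)
      ≡⟨ regroup′ s a b a⁻¹ b⁻¹ x y x′ y′ ⟩
    (s * (a * a⁻¹) + a⁻¹) * (x * x′) - s * (x * y′ + y * x′) + s * (b * b⁻¹) * (y * y′)
      ≡⟨ cong₂ (λ u v → (s * u + a⁻¹) * (x * x′) - s * (x * y′ + y * x′) + s * v * (y * y′))
           aa⁻¹≡1 bb⁻¹≡1 ⟩
    (s * 1ℚ + a⁻¹) * (x * x′) - s * (x * y′ + y * x′) + s * 1ℚ * (y * y′)
      ≡⟨ factor s a⁻¹ x y x′ y′ ⟩
    a⁻¹ * (x * x′) + s * ((x - y) * (x′ - y′)) ∎)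
    where
    collect : ∀ s a b a⁻¹ b⁻¹ x y x′ y′ →
      s * b * a⁻¹ * ((x - a * b⁻¹ * y) * (x′ - a * b⁻¹ * y′)) + b⁻¹ * (y * y′)
      ≡ s * b * a⁻¹ * (x * x′) - s * (a * a⁻¹) * (b * b⁻¹) * (x * y′ + y * x′)
        + (s * (a * a⁻¹) * (b * b⁻¹) * (a * b⁻¹) + b⁻¹) * (y * y′)
    collect = solve-∀ ring
    regroup : ∀ t s a a⁻¹ b⁻¹ x y x′ y′ →
      t * a⁻¹ * (x * x′) - s * 1ℚ * 1ℚ * (x * y′ + y * x′)
        + (s * 1ℚ * 1ℚ * (a * b⁻¹) + b⁻¹) * (y * y′)
      ≡ t * a⁻¹ * (x * x′) - s * (x * y′ + y * x′) + (s * a + 1ℚ) * b⁻¹ * (y * y′)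
    regroup = solve-∀ ring
    regroup′ : ∀ s a b a⁻¹ b⁻¹ x y x′ y′ →
      (s * a + 1ℚ) * a⁻¹ * (x * x′) - s * (x * y′ + y * x′) + s * b * b⁻¹ * (y * y′)
      ≡ (s * (a * a⁻¹) + a⁻¹) * (x * x′) - s * (x * y′ + y * x′) + s * (b * b⁻¹) * (y * y′)
    regroup′ = solve-∀ ring
    factor : ∀ s a⁻¹ x y x′ y′ →
      (s * 1ℚ + a⁻¹) * (x * x′) - s * (x * y′ + y * x′) + s * 1ℚ * (y * y′)
      ≡ a⁻¹ * (x * x′) + s * ((x - y) * (x′ - y′))
    factor = solve-∀ ring

-- Pivots

-- Kept in the integer form of the theorem, so that the two agree by computation.
β : ℕ → ℚ
β ℓ = (((ℤ.+ ℓ) ℤ.^ 2 ℤ.* (ℤ.+ 2 ℤ.* ℤ.+ ℓ ℤ.+ ℤ.+ 1) ℤ.* (ℤ.+ 2 ℤ.* ℤ.+ ℓ ℤ.- ℤ.+ 1)) / 4)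

β-suc : ∀ i → β (suc i) ≡ fromℕ (suc i) * fromℕ (suc i) * odd (suc i) * odd i * (ℤ.+ 1 / 4)
β-suc i = trans (/4≡*¼ (l ℤ.^ 2 ℤ.* (ℤ.+ 2 ℤ.* l ℤ.+ ℤ.+ 1) ℤ.* (ℤ.+ 2 ℤ.* l ℤ.- ℤ.+ 1)))
  (cong (_* (ℤ.+ 1 / 4)) (begin
    (l ℤ.^ 2 ℤ.* (ℤ.+ 2 ℤ.* l ℤ.+ ℤ.+ 1) ℤ.* (ℤ.+ 2 ℤ.* l ℤ.- ℤ.+ 1)) / 1
      ≡⟨ cong (_/ 1) (cong₂ ℤ._*_ (cong₂ ℤ._*_ (cong (l ℤ.*_) (ℤ.*-identityʳ l)) 2l+1) 2l-1) ⟩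
    (l ℤ.* l ℤ.* ℤ.+ suc (double (suc i)) ℤ.* ℤ.+ suc (double i)) / 1
      ≡⟨ /1-homo-* (l ℤ.* l ℤ.* ℤ.+ suc (double (suc i))) (ℤ.+ suc (double i)) ⟩
    (l ℤ.* l ℤ.* ℤ.+ suc (double (suc i))) / 1 * odd i
      ≡⟨ cong (_* odd i) (/1-homo-* (l ℤ.* l) (ℤ.+ suc (double (suc i)))) ⟩
    (l ℤ.* l) / 1 * odd (suc i) * odd i
      ≡⟨ cong (λ z → z * odd (suc i) * odd i) (/1-homo-* l l) ⟩
    fromℕ (suc i) * fromℕ (suc i) * odd (suc i) * odd i ∎))
  where
  l = ℤ.+ suc i
  2l : ℤ.+ 2 ℤ.* l ≡ ℤ.+ double (suc i)
  2l = trans (sym (ℤ.pos-* 2 (suc i))) (cong ℤ.+_ (sym (double≡2* (suc i))))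
  2l+1 : ℤ.+ 2 ℤ.* l ℤ.+ ℤ.+ 1 ≡ ℤ.+ suc (double (suc i))
  2l+1 = trans (cong (ℤ._+ ℤ.+ 1) 2l) (cong ℤ.+_ (ℕ.+-comm (double (suc i)) 1))
  2l-1 : ℤ.+ 2 ℤ.* l ℤ.- ℤ.+ 1 ≡ ℤ.+ suc (double i)
  -- Once the minuend is `double (suc i)`, visibly a successor, the integer subtraction computes.
  2l-1 = cong (ℤ._- ℤ.+ 1) 2l

T-diag : ∀ n → T (suc n) (suc n) ≡ ½ * fromℕ (suc n) * T n n
T-diag n = trans
  (cong (λ z → ½ * fromℕ (suc n) * (T n n - z)) (T-upper (ℕ.m<n⇒m<1+n (ℕ.n<1+n n))))
  (cong (½ * fromℕ (suc n) *_) (+-identityʳ (T n n)))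

-- By `T-diag`, `T n n` is n!/2^n; this is 2^n/n!.
T-diag⁻¹ : ℕ → ℚ
T-diag⁻¹ zero    = 1ℚ
T-diag⁻¹ (suc n) = fromℕ 2 * (ℤ.+ 1 / suc n) * T-diag⁻¹ n

T-diag-inverse : ∀ n → T n n * T-diag⁻¹ n ≡ 1ℚ
T-diag-inverse zero    = refl
T-diag-inverse (suc n) = begin
  T (suc n) (suc n) * (fromℕ 2 * (ℤ.+ 1 / suc n) * T-diag⁻¹ n)
    ≡⟨ cong (_* (fromℕ 2 * (ℤ.+ 1 / suc n) * T-diag⁻¹ n)) (T-diag n) ⟩
  ½ * fromℕ (suc n) * T n n * (fromℕ 2 * (ℤ.+ 1 / suc n) * T-diag⁻¹ n)
    ≡⟨ pair (fromℕ (suc n)) (T n n) (ℤ.+ 1 / suc n) (T-diag⁻¹ n) ⟩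
  fromℕ (suc n) * (ℤ.+ 1 / suc n) * (T n n * T-diag⁻¹ n)
    ≡⟨ cong₂ _*_ (fromℕ-*-recip n) (T-diag-inverse n) ⟩
  1ℚ ∎
  where
  pair : ∀ a t r s → ½ * a * t * (fromℕ 2 * r * s) ≡ a * r * (t * s)
  pair = solve-∀ ring

-- `W i i` is (2i)!/4^i, so raising i multiplies the left side by ((2i+2)(2i+1)/4)² (2i+3)/(2i+1),
-- which simplifies to `β (suc i)`.
W-diag² : ∀ i → odd i * (W i i * W i i) ≡ ∏[1≤ ℓ ≤ i ] β ℓ
W-diag² zero    = refl
W-diag² (suc i) = begin
  odd (suc i) * (W (suc i) (suc i) * W (suc i) (suc i))
    ≡⟨ cong (λ z → odd (suc i) * (z * z)) (trans (T-diag (suc (double i)))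
         (cong₂ (λ a b → ½ * a * b) 2i+2 (T-diag (double i)))) ⟩
  odd (suc i) * (½ * (fromℕ 2 * fromℕ (suc i)) * (½ * odd i * W i i)
    * (½ * (fromℕ 2 * fromℕ (suc i)) * (½ * odd i * W i i)))
    ≡⟨ collect (odd (suc i)) (fromℕ (suc i)) (odd i) (W i i) ⟩
  odd i * (W i i * W i i) * (fromℕ (suc i) * fromℕ (suc i) * odd (suc i) * odd i * (ℤ.+ 1 / 4))
    ≡⟨ cong₂ _*_ (W-diag² i) (sym (β-suc i)) ⟩
  (∏[1≤ ℓ ≤ i ] β ℓ) * β (suc i)
    ≡⟨ sum-last *-1-monoid i (β ∘ suc) ⟨
  ∏[1≤ ℓ ≤ suc i ] β ℓ ∎
  where
  2i+2 : fromℕ (double (suc i)) ≡ fromℕ 2 * fromℕ (suc i)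
  2i+2 = trans (cong fromℕ (double≡2* (suc i))) (fromℕ-homo-* 2 (suc i))
  collect : ∀ s a o w → s * (½ * (fromℕ 2 * a) * (½ * o * w) * (½ * (fromℕ 2 * a) * (½ * o * w)))
    ≡ o * (w * w) * (a * a * s * o * (ℤ.+ 1 / 4))
  collect = solve-∀ ring

-- The LU decomposition

D D⁻¹ : ℕ → ℚ
D m = W (suc m) (suc m)
D⁻¹ m = T-diag⁻¹ (double (suc m))

L-upper : ∀ {p i} → i ℕ.< p → L p i ≡ 0ℚ
L-upper {p} i<p = trans
  (cong₂ (λ a b → a - H̅ p * H̅⁻¹ (suc p) * b) (W-upper (ℕ.s≤s i<p)) (W-upper (ℕ.s≤s (ℕ.m<n⇒m<1+n i<p))))
  (vanish (H̅ p * H̅⁻¹ (suc p)))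
  where
  vanish : ∀ a → 0ℚ - a * 0ℚ ≡ 0ℚ
  vanish = solve-∀ ring

L-diag : ∀ i → L i i ≡ D i
L-diag i = trans
  (cong (λ z → D i - H̅ i * H̅⁻¹ (suc i) * z) (W-upper (ℕ.n<1+n (suc i))))
  (vanish (D i) (H̅ i * H̅⁻¹ (suc i)))
  where
  vanish : ∀ d a → d - a * 0ℚ ≡ d
  vanish = solve-∀ ring

-- The diagonalised form is symmetric in its two factors `L`. Moving `D`, the diagonal of `L`,
-- together with the pivots to the left makes the right factor unitriangular.
A U : ℕ → ℕ → ℚ
A i m = ½ * (pivot m * (L m i * D m))
U m j = L m j * D⁻¹ m

E-Hankel-LU : ∀ n {i j} → i ℕ.≤ n → j ℕ.≤ n →
  E (2 ℕ.* (i ℕ.+ j) ℕ.+ 5) 1ℚ ≡ ∑[ m < suc n ] (A i (toℕ m) * U (toℕ m) j)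
E-Hankel-LU n {i} {j} i≤n j≤n = begin
  E (2 ℕ.* (i ℕ.+ j) ℕ.+ 5) 1ℚ
    ≡⟨ trans (E-odd (i ℕ.+ j)) (cong (V 0 ∘ suc) (sym (ℕ.+-suc i j))) ⟩
  V 0 (suc i ℕ.+ suc j)
    -- With n + 2 links, n + 1 squares are split off, matching the size of the matrix, and the
    -- residual term carries w_{n+2}, which vanishes at i + 1.
    ≡⟨ V₀-Hankel (suc (suc n)) (suc i) (suc j) (ℕ.s≤s (ℕ.s≤s j≤n)) ⟩
  ½ * C (suc (suc n)) (suc i) (suc j)
    ≡⟨ cong (½ *_) (C-diagonalised (suc n) i j) ⟩
  ½ * (∑[ p < suc n ] t (toℕ p) + H̅⁻¹ (suc n) * (W (suc (suc n)) (suc i) * W (suc (suc n)) (suc j)))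
    ≡⟨ cong (λ z → ½ * (∑[ p < suc n ] t (toℕ p) + H̅⁻¹ (suc n) * (z * W (suc (suc n)) (suc j))))
         (W-upper (ℕ.s≤s (ℕ.s≤s i≤n))) ⟩
  ½ * (∑[ p < suc n ] t (toℕ p) + H̅⁻¹ (suc n) * (0ℚ * W (suc (suc n)) (suc j)))
    ≡⟨ vanish (∑[ p < suc n ] t (toℕ p)) (H̅⁻¹ (suc n)) (W (suc (suc n)) (suc j)) ⟩
  ½ * ∑[ p < suc n ] t (toℕ p)
    ≡⟨ *-distribˡ-sum {suc n} ½ (t ∘ toℕ) ⟩
  ∑[ p < suc n ] (½ * t (toℕ p))
    ≡⟨ sum-cong-≗ {suc n} (λ p → split (toℕ p)) ⟩
  ∑[ m < suc n ] (A i (toℕ m) * U (toℕ m) j) ∎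
  where
  t : ℕ → ℚ
  t p = pivot p * (L p i * L p j)
  vanish : ∀ x y z → ½ * (x + y * (0ℚ * z)) ≡ ½ * x
  vanish = solve-∀ ring
  split : ∀ p → ½ * t p ≡ A i p * U p j
  split p = begin
    ½ * t p
      ≡⟨ *-identityʳ (½ * t p) ⟨
    ½ * t p * 1ℚ
      ≡⟨ cong (½ * t p *_) (T-diag-inverse (double (suc p))) ⟨
    ½ * t p * (D p * D⁻¹ p)
      ≡⟨ rearrange (pivot p) (L p i) (L p j) (D p) (D⁻¹ p) ⟩
    A i p * U p j ∎
    where
    rearrange : ∀ q a b d e → ½ * (q * (a * b)) * (d * e) ≡ ½ * (q * (a * d)) * (b * e)
    rearrange = solve-∀ ring

-- Separates the ratio of consecutive `H̅`, which telescopes over the diagonal, from the product of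
-- the `β`.
A-diag : ∀ i → A i i ≡ ½ * (H̅ (suc i) * H̅⁻¹ i * ∏₁ (suc i) β)
A-diag i = begin
  ½ * (odd (suc i) * H̅ (suc i) * H̅⁻¹ i * (L i i * D i))
    ≡⟨ cong (λ z → ½ * (odd (suc i) * H̅ (suc i) * H̅⁻¹ i * (z * D i))) (L-diag i) ⟩
  ½ * (odd (suc i) * H̅ (suc i) * H̅⁻¹ i * (D i * D i))
    ≡⟨ rearrange (odd (suc i)) (H̅ (suc i)) (H̅⁻¹ i) (D i) ⟩
  ½ * (H̅ (suc i) * H̅⁻¹ i * (odd (suc i) * (D i * D i)))
    ≡⟨ cong (λ z → ½ * (H̅ (suc i) * H̅⁻¹ i * z)) (W-diag² (suc i)) ⟩
  ½ * (H̅ (suc i) * H̅⁻¹ i * ∏₁ (suc i) β) ∎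
  where
  rearrange : ∀ o h r d → ½ * (o * h * r * (d * d)) ≡ ½ * (h * r * (o * (d * d)))
  rearrange = solve-∀ ring

open import Data.Integer.Base using (+_)

proposition5p1 : (n : ℕ) →
    H n (λ k → E (2 ℕ.* k ℕ.+ 5) 1ℚ)
    ≡ ½ ^ suc n * H̅ (suc n)
    * (∏[1≤ ℓ ≤ suc n ]
    (((+ ℓ) ℤ.^ 2 ℤ.* (+ 2 ℤ.* + ℓ ℤ.+ + 1) ℤ.* (+ 2 ℤ.* + ℓ ℤ.- + 1)) / 4) ^ (n ℕ.+ 2 ∸ ℓ))
proposition5p1 n = begin
  H n (λ k → E (2 ℕ.* k ℕ.+ 5) 1ℚ)
    ≡⟨ det-cong {suc n} (λ i j → E-Hankel-LU n (toℕ≤pred[n] i) (toℕ≤pred[n] j)) ⟩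
  det {suc n} (λ i j → ∑[ m < suc n ] (A (toℕ i) (toℕ m) * U (toℕ m) (toℕ j)))
    ≡⟨ det-LU (suc n) A U A-lower U-upper U-diag ⟩
  product {suc n} (λ i → A (toℕ i) (toℕ i))
    ≡⟨ product-cong {suc n} (λ i → A-diag (toℕ i)) ⟩
  product {suc n} (λ i → ½ * (ratio (toℕ i) * ∏₁ (suc (toℕ i)) β))
    ≡⟨ trans (∏-distrib-* {suc n} (λ _ → ½) (λ i → ratio (toℕ i) * ∏₁ (suc (toℕ i)) β))
         (cong₂ _*_ (product-replicate (suc n) {½})
           (∏-distrib-* {suc n} (ratio ∘ toℕ) (λ i → ∏₁ (suc (toℕ i)) β))) ⟩
  ½ ^ suc n * (product {suc n} (ratio ∘ toℕ) * product {suc n} (λ i → ∏₁ (suc (toℕ i)) β))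
    ≡⟨ cong₂ (λ x y → ½ ^ suc n * (x * y))
         -- The telescoped product ends in `H̅⁻¹ 0`, which computes to 1.
         (trans (product-telescope (suc n) H̅ H̅⁻¹ H̅-inverse) (*-identityʳ (H̅ (suc n))))
         (∏-∏₁ (suc n) β) ⟩
  ½ ^ suc n * (H̅ (suc n) * (∏[1≤ ℓ ≤ suc n ] (β ℓ ^ (2 ℕ.+ n ∸ ℓ))))
    ≡⟨ *-assoc (½ ^ suc n) (H̅ (suc n)) _ ⟨
  ½ ^ suc n * H̅ (suc n) * (∏[1≤ ℓ ≤ suc n ] (β ℓ ^ (2 ℕ.+ n ∸ ℓ)))
    ≡⟨ cong (λ k → ½ ^ suc n * H̅ (suc n) * (∏[1≤ ℓ ≤ suc n ] (β ℓ ^ (k ∸ ℓ)))) (ℕ.+-comm 2 n) ⟩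
  ½ ^ suc n * H̅ (suc n) * (∏[1≤ ℓ ≤ suc n ] (β ℓ ^ (n ℕ.+ 2 ∸ ℓ))) ∎
  where
  ratio : ℕ → ℚ
  ratio i = H̅ (suc i) * H̅⁻¹ i
  A-lower : ∀ {i m} → i ℕ.< m → A i m ≡ 0ℚ
  A-lower {i} {m} i<m = trans (cong (λ z → ½ * (pivot m * (z * D m))) (L-upper i<m)) (vanish (pivot m) (D m))
    where
    vanish : ∀ a d → ½ * (a * (0ℚ * d)) ≡ 0ℚ
    vanish = solve-∀ ring
  U-upper : ∀ {m j} → j ℕ.< m → U m j ≡ 0ℚ
  U-upper {m} j<m = trans (cong (_* D⁻¹ m) (L-upper j<m)) (*-zeroˡ (D⁻¹ m))
  U-diag : ∀ m → U m m ≡ 1ℚ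
  U-diag m = trans (cong (_* D⁻¹ m) (L-diag m)) (T-diag-inverse (double (suc m)))
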